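{- For all integers $n\geq k\geq1$, \[\sum_{j=k}^{n}A_{n,j}B_{j,k}=\delta_{n,k}\qquad\text{and}\qquad\sum_{j=k}^{n}B_{n,j}A_{j,k}=\delta_{n,k},\] where $\delta_{n,k}$ is the Kronecker delta.
   Context: Let $R=\mathbb{Z}[X_1,X_1^{ -1},X_2,X_3,\ldots]$. Partial exponential Bell polynomials: $B_{0,0}=1$, $B_{n,0}=0$ for $n\geq1$, $B_{n,k}=0$ for $0\leq n<k$, and for $1\leq k\leq n$, $B_{n,k}=\sum \frac{n!}{r_1!\cdots r_{n-k+1}!\,(1!)^{r_1}\cdots((n-k+1)!)^{r_{n-k+1}}}X_1^{r_1}\cdots X_{n-k+1}^{r_{n-k+1}}$, summed over nonnegative integers $r_i$ with $\sum r_i=k$, $\sum i r_i=n$. Elements $S_{n,k}\in R$ are defined by $S_{0,0}=X_1^{ -1}$, $S_{n,0}=0$ ($n\geq1$), $S_{n,k}=0$ ($0\leq n<k$), and for $n\geq0$, $1\leq k\leq n+1$: $S_{n+1,k}=-(2n-1)X_2S_{n,k}+X_1\big(S_{n,k-1}+\sum_{j=1}^{n-k+1}X_{j+1}\,\partial S_{n,k}/\partial X_j\big)$. Set $A_{n,k}:=X_1^{ -(2n-1)}S_{n,k}$. -}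

module Defs where

open import Data.Nat as ℕ using (ℕ; zero; suc; _∸_; _≤_; _≡ᵇ_)
open import Data.Nat.DivMod using (_/_)
open import Data.Nat using (_!)
open import Data.Integer as ℤ using (ℤ; +_; -[1+_])
open import Data.Bool using (Bool; true; false; if_then_else_; _∧_)
open import Data.List using (List; []; _∷_; _++_; map; concatMap; foldr; upTo; filterᵇ)
open import Relation.Binary.PropositionalEquality using (_≡_)

-- The ring R = ℤ[X₁, X₁⁻¹, X₂, X₃, …], represented concretely.
-- A monomial is X₁^e₁ · X₂^a₀ · X₃^a₁ · …  with e₁ : ℤ and the
-- exponents of X₂, X₃, … given by a list (missing entries = 0).
-- A polynomial is a finite formal sum (list) of terms  c · monomial.

record Term : Set where
  constructor term
  field
    coef : ℤ
    e₁   : ℤ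
    rest : List ℕ

Poly : Set
Poly = List Term

eqExps : List ℕ → List ℕ → Bool
eqExps []       []       = true
eqExps []       (b ∷ bs) = (b ≡ᵇ 0) ∧ eqExps [] bs
eqExps (a ∷ as) []       = (a ≡ᵇ 0) ∧ eqExps as []
eqExps (a ∷ as) (b ∷ bs) = (a ≡ᵇ b) ∧ eqExps as bs

eqℤᵇ : ℤ → ℤ → Bool
eqℤᵇ (+ m)    (+ n)    = m ≡ᵇ n
eqℤᵇ -[1+ m ] -[1+ n ] = m ≡ᵇ n
eqℤᵇ _        _        = false

coeff : Poly → ℤ → List ℕ → ℤ
coeff []                  e as = + 0
coeff (term c f bs ∷ p)   e as =
  (if eqℤᵇ f e ∧ eqExps bs as then c else + 0) ℤ.+ coeff p e as

infix 4 _≈_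
_≈_ : Poly → Poly → Set
p ≈ q = ∀ (e : ℤ) (as : List ℕ) → coeff p e as ≡ coeff q e as

0R : Poly
0R = []

1R : Poly
1R = term (+ 1) (+ 0) [] ∷ []

infixl 6 _+R_
_+R_ : Poly → Poly → Poly
p +R q = p ++ q

addExps : List ℕ → List ℕ → List ℕ
addExps []       bs       = bs
addExps as       []       = as
addExps (a ∷ as) (b ∷ bs) = (a ℕ.+ b) ∷ addExps as bs

mulTerm : Term → Term → Term
mulTerm (term c e as) (term d f bs) = term (c ℤ.* d) (e ℤ.+ f) (addExps as bs)

infixl 7 _*R_
_*R_ : Poly → Poly → Poly
p *R q = concatMap (λ s → map (mulTerm s) q) p

scale : ℤ → Poly → Poly
scale c = map (λ { (term d e as) → term (c ℤ.* d) e as })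

X₁^ : ℤ → Poly
X₁^ e = term (+ 1) e [] ∷ []

unitExps : ℕ → ℕ → List ℕ
unitExps zero    m = m ∷ []
unitExps (suc i) m = 0 ∷ unitExps i m

-- the variable X_j (j ≥ 1); X 0 is never used (set to 0)
X : ℕ → Poly
X zero          = 0R
X (suc zero)    = X₁^ (+ 1)
X (suc (suc i)) = term (+ 1) (+ 0) (unitExps i 1) ∷ []

Xpow : ℕ → ℕ → Poly
Xpow zero          m = 0R
Xpow (suc zero)    m = X₁^ (+ m)
Xpow (suc (suc i)) m = term (+ 1) (+ 0) (unitExps i m) ∷ []

lookupExp : List ℕ → ℕ → ℕ
lookupExp []       i       = 0
lookupExp (a ∷ as) zero    = a
lookupExp (a ∷ as) (suc i) = lookupExp as i

decExp : List ℕ → ℕ → List ℕ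
decExp []       i       = []
decExp (a ∷ as) zero    = (a ∸ 1) ∷ as
decExp (a ∷ as) (suc i) = a ∷ decExp as i

∂ : ℕ → Poly → Poly
∂ zero          p = 0R
∂ (suc zero)    p = map (λ { (term c e as) → term (c ℤ.* e) (e ℤ.- + 1) as }) p
∂ (suc (suc i)) p =
  map (λ { (term c e as) → term (c ℤ.* + lookupExp as i) e (decExp as i) }) p

-- Σ_{j=a}^{b} f j  (empty if b < a)
sumFromTo : ℕ → ℕ → (ℕ → Poly) → Poly
sumFromTo a b f = go (suc b ∸ a)
  where
  go : ℕ → Poly
  go zero    = 0R
  go (suc m) = go m +R f (a ℕ.+ m)

-- Partial exponential Bell polynomials, by the explicit formula.

tuples : ℕ → ℕ → List (List ℕ)
tuples zero    k = [] ∷ []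
tuples (suc m) k =
  concatMap (λ r → map (r ∷_) (tuples m k)) (upTo (suc k))

sumR : List ℕ → ℕ
sumR = foldr ℕ._+_ 0

weightedSum : ℕ → List ℕ → ℕ
weightedSum i []       = 0
weightedSum i (r ∷ rs) = i ℕ.* r ℕ.+ weightedSum (suc i) rs

denom : ℕ → List ℕ → ℕ
denom i []       = 1
denom i (r ∷ rs) = (r !) ℕ.* ((i !) ℕ.^ r) ℕ.* denom (suc i) rs

-- exact division (the denominator is never 0; the 0-case is a dummy)
divℕ : ℕ → ℕ → ℕ
divℕ a zero    = 0
divℕ a (suc d) = a / suc d

monoR : ℕ → List ℕ → Poly
monoR i []       = 1R
monoR i (r ∷ rs) = Xpow i r *R monoR (suc i) rs

isSol : ℕ → ℕ → List ℕ → Bool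
isSol n k rs = (sumR rs ≡ᵇ k) ∧ (weightedSum 1 rs ≡ᵇ n)

B : ℕ → ℕ → Poly
B zero    zero    = 1R
B (suc n) zero    = 0R
B n       (suc k') with ℕ._<ᵇ_ n (suc k')
... | true  = 0R
... | false =
  foldr _+R_ 0R
    (map (λ rs → scale (+ divℕ (n !) (denom 1 rs)) (monoR 1 rs))
         (filterᵇ (isSol n (suc k')) (tuples (n ∸ k') (suc k'))))

S : ℕ → ℕ → Poly
S zero    zero    = X₁^ (ℤ.- + 1)
S zero    (suc k) = 0R
S (suc n) zero    = 0R
S (suc n) (suc k') with ℕ._<ᵇ_ (suc n) (suc k')
... | true  = 0R
... | false =
  scale (ℤ.- (+ (2 ℕ.* n) ℤ.- + 1)) (X 2 *R S n (suc k'))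
  +R X 1 *R (S n k'
             +R sumFromTo 1 (n ∸ k') (λ j → X (suc j) *R ∂ j (S n (suc k'))))

A : ℕ → ℕ → Poly
A n k = X₁^ (ℤ.- (+ (2 ℕ.* n) ℤ.- + 1)) *R S n k

δ : ℕ → ℕ → Poly
δ n k with n ≡ᵇ k
... | true  = 1R
... | false = 0R

{-# OPTIONS --safe #-}
module Submission where

-- With the derivation D = ∑ⱼ X_{j+1} ∂/∂X_j, the defining recurrence of S becomes
-- A_{n+1,k+1} = X₁⁻¹ (A_{n,k} + D A_{n,k+1}), and comparing coefficients gives
-- B_{n+1,k+1} = X₁ B_{n,k} + D B_{n,k+1}.  By the Leibniz rule, entry (n + 1 , k + 1) of
-- either product of the two triangles is its entry (n , k) plus a multiple of D of its
-- entry (n , k + 1), and D kills constants; so both products are the identity matrix by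
-- induction on n.

open import Algebra.Bundles using (CommutativeSemiring)
open import Data.Nat.Base as ℕ using (ℕ; zero; suc; _∸_; _≤_; _<_; z≤n; s≤s; _≡ᵇ_; _!)
import Data.Nat.Properties as ℕ
open import Level as Level using (0ℓ)
open import Relation.Binary.PropositionalEquality as ≡ using (_≡_)

-- D is an infinite sum, whereas polynomials here are finite lists. It is therefore cut at an index
-- `N` fixed before the induction, so that one derivation serves all the rows used. The cut loses
-- nothing: S_{n,k} involves only X_1, ..., X_{n-k+1}, and no exponent r_i with i > n + 1 can be
-- nonzero when the sum of the i r_i is n + 1. One lemma covers both products. A triangle enters it
-- only through the coefficients (a, b) of its recurrence, which are (X_1⁻¹, X_1⁻¹) for A and (X_1,
-- 1) for B; the required relations a a′ = 1 and a b′ = b hold in either order. The recurrence for B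
-- is the laborious one, because its coefficients are quotients of factorials. After multiplication
-- by the denominators it says no more than that the i r_i sum to n + 1. Since equality means
-- equality of all coefficients and not of lists, multiplication and differentiation must first be
-- shown to respect it.

module Derivations {c ℓ} (R : CommutativeSemiring c ℓ) where
  open CommutativeSemiring R
  open import Relation.Binary.Reasoning.Setoid setoid
  open import Algebra.Properties.CommutativeSemigroup +-commutativeSemigroup using (interchange)
  import Algebra.Solver.Ring.NaturalCoefficients.Default R as Solver

  -- Finite sums in a commutative semiring

  ∑ : ℕ → (ℕ → Carrier) → Carrier
  ∑ zero    f = 0#
  ∑ (suc n) f = ∑ n f + f n

  ∑-cong : ∀ n {f g} → (∀ i → i < n → f i ≈ g i) → ∑ n f ≈ ∑ n g
  ∑-cong zero    f≈g = refl
  ∑-cong (suc n) f≈g =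
    +-cong (∑-cong n λ i i<n → f≈g i (ℕ.m<n⇒m<1+n i<n)) (f≈g n ℕ.≤-refl)

  ∑-zero : ∀ n {f} → (∀ i → i < n → f i ≈ 0#) → ∑ n f ≈ 0#
  ∑-zero zero    f≈0 = refl
  ∑-zero (suc n) f≈0 = trans
    (+-cong (∑-zero n λ i i<n → f≈0 i (ℕ.m<n⇒m<1+n i<n)) (f≈0 n ℕ.≤-refl)) (+-identityˡ 0#)

  ∑-+ : ∀ n f g → ∑ n (λ i → f i + g i) ≈ ∑ n f + ∑ n g
  ∑-+ zero    f g = sym (+-identityˡ 0#)
  ∑-+ (suc n) f g = trans (+-congʳ (∑-+ n f g)) (interchange _ _ _ _)

  ∑-*ˡ : ∀ n x f → ∑ n (λ i → x * f i) ≈ x * ∑ n f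
  ∑-*ˡ zero    x f = sym (zeroʳ x)
  ∑-*ˡ (suc n) x f = trans (+-congʳ (∑-*ˡ n x f)) (sym (distribˡ x _ _))

  ∑-head : ∀ n f → ∑ (suc n) f ≈ f 0 + ∑ n (λ i → f (suc i))
  ∑-head zero    f = +-comm 0# (f 0)
  ∑-head (suc n) f = trans (+-congʳ (∑-head n f)) (+-assoc _ _ _)

  -- Both boundary terms vanish. This realigns the two halves of the Leibniz rule in
  -- `orthogonality`, whose indices differ by one.
  ∑-shift : ∀ n f → f 0 ≈ 0# → f n ≈ 0# → ∑ n (λ i → f (suc i)) ≈ ∑ n f
  ∑-shift n f f₀≈0 fₙ≈0 = begin
    ∑ n (λ i → f (suc i))        ≈⟨ +-identityˡ _ ⟨
    0# + ∑ n (λ i → f (suc i))   ≈⟨ +-congʳ f₀≈0 ⟨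
    f 0 + ∑ n (λ i → f (suc i))  ≈⟨ ∑-head n f ⟨
    ∑ n f + f n                  ≈⟨ +-congˡ fₙ≈0 ⟩
    ∑ n f + 0#                   ≈⟨ +-identityʳ _ ⟩
    ∑ n f                        ∎

  ∑-extend : ∀ {m n} → m ≤ n → ∀ f → (∀ i → m ≤ i → f i ≈ 0#) → ∑ m f ≈ ∑ n f
  ∑-extend {m} m≤n f f≈0 = go (ℕ.≤⇒≤′ m≤n)
    where
    go : ∀ {n} → m ℕ.≤′ n → ∑ m f ≈ ∑ n f
    go (ℕ.≤′-reflexive ≡.refl) = refl
    go (ℕ.≤′-step p) =
      trans (go p) (sym (trans (+-congˡ (f≈0 _ (ℕ.≤′⇒≤ p))) (+-identityʳ _)))

  ∑-drop : ∀ {m n} → m ≤ n → ∀ f → (∀ i → i < m → f i ≈ 0#) →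
           ∑ (n ∸ m) (λ i → f (m ℕ.+ i)) ≈ ∑ n f
  ∑-drop z≤n f f≈0 = refl
  ∑-drop {suc m} {suc n} (s≤s m≤n) f f≈0 = begin
    ∑ (n ∸ m) (λ i → f (suc (m ℕ.+ i)))  ≈⟨ ∑-drop m≤n _ (λ i i<m → f≈0 (suc i) (s≤s i<m)) ⟩
    ∑ n (λ i → f (suc i))                ≈⟨ +-identityˡ _ ⟨
    0# + ∑ n (λ i → f (suc i))           ≈⟨ +-congʳ (f≈0 0 (s≤s z≤n)) ⟨
    f 0 + ∑ n (λ i → f (suc i))          ≈⟨ ∑-head n f ⟨
    ∑ (suc n) f                          ∎

  -- Derivations

  record IsDerivation (d : Carrier → Carrier) : Set (c Level.⊔ ℓ) where
    field
      d-cong : ∀ {x y} → x ≈ y → d x ≈ d y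
      d-0#   : d 0# ≈ 0#
      d-1#   : d 1# ≈ 0#
      d-+    : ∀ x y → d (x + y) ≈ d x + d y
      d-*    : ∀ x y → d (x * y) ≈ d x * y + x * d y

    d-∑ : ∀ n f → d (∑ n f) ≈ ∑ n (λ i → d (f i))
    d-∑ zero    f = d-0#
    d-∑ (suc n) f = trans (d-+ _ _) (+-congʳ (d-∑ n f))

    d-*-zero : ∀ {x y} → d x ≈ 0# → d y ≈ 0# → d (x * y) ≈ 0#
    d-*-zero {x} {y} dx≈0 dy≈0 = begin
      d (x * y)          ≈⟨ d-* x y ⟩
      d x * y + x * d y  ≈⟨ +-cong (*-congʳ dx≈0) (*-congˡ dy≈0) ⟩
      0# * y + x * 0#    ≈⟨ +-cong (zeroˡ y) (zeroʳ x) ⟩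
      0# + 0#            ≈⟨ +-identityˡ 0# ⟩
      0#                 ∎

    d-+-zero : ∀ {x y} → d x ≈ 0# → d y ≈ 0# → d (x + y) ≈ 0#
    d-+-zero dx≈0 dy≈0 = trans (d-+ _ _) (trans (+-cong dx≈0 dy≈0) (+-identityˡ 0#))

  ∑-isDerivation : ∀ n (x : ℕ → Carrier) {d : ℕ → Carrier → Carrier} →
                   (∀ i → IsDerivation (d i)) → IsDerivation (λ y → ∑ n (λ i → x i * d i y))
  ∑-isDerivation n x {d} isD = record
    { d-cong = λ y≈z → ∑-cong n λ i _ → *-congˡ (d-cong (isD i) y≈z)
    ; d-0#   = ∑-zero n λ i _ → trans (*-congˡ (d-0# (isD i))) (zeroʳ (x i))
    ; d-1#   = ∑-zero n λ i _ → trans (*-congˡ (d-1# (isD i))) (zeroʳ (x i))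
    ; d-+    = λ y z → trans
        (∑-cong n λ i _ → trans (*-congˡ (d-+ (isD i) y z)) (distribˡ (x i) _ _)) (∑-+ n _ _)
    ; d-*    = λ y z → begin
        ∑ n (λ i → x i * d i (y * z))
          ≈⟨ ∑-cong n (λ i _ → trans (*-congˡ (d-* (isD i) y z)) (rearrange (x i) (d i y) z y (d i z))) ⟩
        ∑ n (λ i → z * (x i * d i y) + y * (x i * d i z))
          ≈⟨ ∑-+ n _ _ ⟩
        ∑ n (λ i → z * (x i * d i y)) + ∑ n (λ i → y * (x i * d i z))
          ≈⟨ +-cong (trans (∑-*ˡ n z _) (*-comm z _)) (∑-*ˡ n y _) ⟩
        ∑ n (λ i → x i * d i y) * z + y * ∑ n (λ i → x i * d i z) ∎
    }
    where
    open IsDerivation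
    rearrange : ∀ a b c e f → a * (b * c + e * f) ≈ c * (a * b) + e * (a * f)
    rearrange = solve 5 (λ a b c e f → a :* (b :* c :+ e :* f) := c :* (a :* b) :+ e :* (a :* f)) refl
      where open Solver

  -- Triangles with a differential recurrence, and their products

  -- Recursion on both indices makes the diagonal shift from (n + 1, k + 1) to (n, k) definitional,
  -- which is the step taken in `orthogonality`.
  kronecker : ℕ → ℕ → Carrier
  kronecker zero    zero    = 1#
  kronecker zero    (suc _) = 0#
  kronecker (suc _) zero    = 0#
  kronecker (suc n) (suc k) = kronecker n k

  -- The recurrence is demanded only below row `N`, since a derivation truncated at `N` cannot
  -- satisfy it in all rows.
  record IsTriangle (N : ℕ) (d : Carrier → Carrier) (a b : Carrier)
                    (P : ℕ → ℕ → Carrier) : Set ℓ where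
    field
      corner : P 0 0 ≈ 1#
      column : ∀ n → P (suc n) 0 ≈ 0#
      lower  : ∀ {n k} → n < k → P n k ≈ 0#
      step   : ∀ {n} k → n < N → P (suc n) (suc k) ≈ a * P n k + b * d (P n (suc k))

  module _ {d : Carrier → Carrier} (isD : IsDerivation d) where
    open IsDerivation isD

    d-kronecker : ∀ n k → d (kronecker n k) ≈ 0#
    d-kronecker zero    zero    = d-1#
    d-kronecker zero    (suc k) = d-0#
    d-kronecker (suc n) zero    = d-0#
    d-kronecker (suc n) (suc k) = d-kronecker n k

    -- Multiplying the recurrence of `Q` by `a` turns a′ into 1 and b′ into `b`, so that both
    -- derivative terms of a product carry the same factor `b`. The claim is made for all `k` at
    -- once because row n + 1 at column k + 1 uses row n at columns k and k + 1.
    orthogonality : ∀ {N a b a′ b′ P Q} → a * a′ ≈ 1# → a * b′ ≈ b →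
                    IsTriangle N d a b P → IsTriangle N d a′ b′ Q →
                    ∀ n → n ≤ N → ∀ k → ∑ (suc n) (λ j → P n j * Q j k) ≈ kronecker n k
    orthogonality {N} {a} {b} {a′} {b′} {P} {Q} aa′≈1 ab′≈b isP isQ = go
      where
      module P = IsTriangle isP
      module Q = IsTriangle isQ

      scaledStep : ∀ {i} k → i < N → a * Q (suc i) (suc k) ≈ Q i k + b * d (Q i (suc k))
      scaledStep {i} k i<N = begin
        a * Q (suc i) (suc k)                           ≈⟨ *-congˡ (Q.step k i<N) ⟩
        a * (a′ * Q i k + b′ * d (Q i (suc k)))         ≈⟨ distribˡ a _ _ ⟩
        a * (a′ * Q i k) + a * (b′ * d (Q i (suc k)))   ≈⟨ +-cong (*-assoc a a′ _) (*-assoc a b′ _) ⟨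
        a * a′ * Q i k + a * b′ * d (Q i (suc k))       ≈⟨ +-cong (*-congʳ aa′≈1) (*-congʳ ab′≈b) ⟩
        1# * Q i k + b * d (Q i (suc k))                ≈⟨ +-congʳ (*-identityˡ _) ⟩
        Q i k + b * d (Q i (suc k))                     ∎

      -- The two derivative terms are out of step: the first belongs to index i of the Leibniz rule,
      -- the second to index i + 1.
      summand : ∀ {n i} k → n < N → i < N →
                P (suc n) (suc i) * Q (suc i) (suc k) ≈
                P n i * Q i k + b * (P n i * d (Q i (suc k)) + d (P n (suc i)) * Q (suc i) (suc k))
      summand {n} {i} k n<N i<N = begin
        P (suc n) (suc i) * q                                       ≈⟨ *-congʳ (P.step i n<N) ⟩
        (a * p + b * d (P n (suc i))) * q                           ≈⟨ regroup₁ a p b _ q ⟩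
        p * (a * q) + b * (d (P n (suc i)) * q)                     ≈⟨ +-congʳ (*-congˡ (scaledStep k i<N)) ⟩
        p * (Q i k + b * d (Q i (suc k))) + b * (d (P n (suc i)) * q) ≈⟨ regroup₂ p _ b _ _ ⟩
        p * Q i k + b * (p * d (Q i (suc k)) + d (P n (suc i)) * q) ∎
        where
        p = P n i
        q = Q (suc i) (suc k)
        open Solver using (solve; _:*_; _:+_; _:=_)
        regroup₁ : ∀ a p b q u → (a * p + b * q) * u ≈ p * (a * u) + b * (q * u)
        regroup₁ = solve 5
          (λ a p b q u → (a :* p :+ b :* q) :* u := p :* (a :* u) :+ b :* (q :* u)) refl
        regroup₂ : ∀ p q b r s → p * (q + b * r) + b * s ≈ p * q + b * (p * r + s)
        regroup₂ = solve 5
          (λ p q b r s → p :* (q :+ b :* r) :+ b :* s := p :* q :+ b :* (p :* r :+ s)) refl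

      go : ∀ n → n ≤ N → ∀ k → ∑ (suc n) (λ j → P n j * Q j k) ≈ kronecker n k
      go zero n≤N zero = trans (+-identityˡ _) (trans (*-cong P.corner Q.corner) (*-identityˡ 1#))
      go zero n≤N (suc k) = trans (+-identityˡ _) (trans (*-congˡ (Q.lower (s≤s z≤n))) (zeroʳ _))
      go (suc n) n≤N zero = ∑-zero (suc (suc n)) λ
        { zero    _ → trans (*-congʳ (P.column n)) (zeroˡ _)
        ; (suc j) _ → trans (*-congˡ (Q.column j)) (zeroʳ _) }
      go (suc n) n<N (suc k) = begin
        ∑ (suc (suc n)) (λ j → P (suc n) j * Q j (suc k))
          ≈⟨ ∑-head (suc n) _ ⟩
        P (suc n) 0 * Q 0 (suc k) + ∑ (suc n) (λ i → P (suc n) (suc i) * Q (suc i) (suc k))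
          ≈⟨ +-congʳ (trans (*-congʳ (P.column n)) (zeroˡ _)) ⟩
        0# + ∑ (suc n) (λ i → P (suc n) (suc i) * Q (suc i) (suc k))
          ≈⟨ +-identityˡ _ ⟩
        ∑ (suc n) (λ i → P (suc n) (suc i) * Q (suc i) (suc k))
          ≈⟨ ∑-cong (suc n) (λ i i≤n → summand k n<N (ℕ.<-≤-trans i≤n n<N)) ⟩
        ∑ (suc n) (λ i → P n i * Q i k + b * (f i + g (suc i)))
          ≈⟨ trans (∑-+ (suc n) _ _) (+-congˡ (∑-*ˡ (suc n) b _)) ⟩
        ∑ (suc n) (λ i → P n i * Q i k) + b * ∑ (suc n) (λ i → f i + g (suc i))
          ≈⟨ +-cong (go n n≤N k) (*-congˡ constant) ⟩
        kronecker n k + b * 0#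
          ≈⟨ trans (+-congˡ (zeroʳ b)) (+-identityʳ _) ⟩
        kronecker n k ∎
        where
        n≤N : n ≤ N
        n≤N = ℕ.<⇒≤ n<N
        f g : ℕ → Carrier
        f i = P n i * d (Q i (suc k))
        g i = d (P n i) * Q i (suc k)
        -- The shift by one is free because `Q 0 (suc k)` and `P n (suc n)` both vanish. What
        -- remains is `d` of an entry that is constant by the induction hypothesis at column k + 1.
        constant : ∑ (suc n) (λ i → f i + g (suc i)) ≈ 0#
        constant = begin
          ∑ (suc n) (λ i → f i + g (suc i))
            ≈⟨ ∑-+ (suc n) _ _ ⟩
          ∑ (suc n) f + ∑ (suc n) (λ i → g (suc i))
            ≈⟨ +-congˡ (∑-shift (suc n) g
                 (trans (*-congˡ (Q.lower (s≤s z≤n))) (zeroʳ _))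
                 (trans (*-congʳ (trans (d-cong (P.lower ℕ.≤-refl)) d-0#)) (zeroˡ _))) ⟩
          ∑ (suc n) f + ∑ (suc n) g
            ≈⟨ trans (+-comm _ _) (sym (∑-+ (suc n) g f)) ⟩
          ∑ (suc n) (λ i → g i + f i)
            ≈⟨ ∑-cong (suc n) (λ i _ → d-* (P n i) (Q i (suc k))) ⟨
          ∑ (suc n) (λ i → d (P n i * Q i (suc k)))
            ≈⟨ d-∑ (suc n) _ ⟨
          d (∑ (suc n) (λ i → P n i * Q i (suc k)))
            ≈⟨ trans (d-cong (go n n≤N (suc k))) (d-kronecker n (suc k)) ⟩
          0# ∎

open import Defs
open import Algebra.Structures.Biased using (isCommutativeSemiringˡ)
open import Data.Bool.Base using (true; false; if_then_else_; _∧_; T)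
open import Data.Bool.Properties using (T-∧)
open import Data.Empty using (⊥-elim)
open import Data.Integer as ℤ using (ℤ; +_; -[1+_]; -1ℤ)
import Data.Integer.Properties as ℤ
open import Data.Integer.Solver using (module +-*-Solver)
open import Data.List.Base using (List; []; _∷_; _++_; map; concatMap; foldr; upTo; applyUpTo; filterᵇ; drop; replicate)
open import Data.List.Properties using (map-cong; concatMap-++; map-++; ++-assoc; ++-identityʳ; map-id; map-∘)
open import Data.Nat.Divisibility using (divides)
open import Data.Nat.DivMod using (m/n*n≡m)
import Data.Nat.Solver as ℕSolver
open import Data.Product using (_×_; _,_)
open import Data.Unit using (tt)
open import Function.Base using (_∘_)
open import Function.Bundles using (Equivalence)
import Relation.Binary.Reasoning.Setoid as SetoidReasoning
open import Relation.Nullary using (¬_; yes; no; contradiction)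
open ≡ using (_≢_; refl; sym; trans; cong; cong₂; subst)

-- Boolean tests and equality of integers

T-ext : ∀ {a b} → (T a → T b) → (T b → T a) → a ≡ b
T-ext {true}  {true}  f g = refl
T-ext {true}  {false} f g = ⊥-elim (f tt)
T-ext {false} {true}  f g = ⊥-elim (g tt)
T-ext {false} {false} f g = refl

∧-T : ∀ {a b} → T a → T b → T (a ∧ b)
∧-T p q = Equivalence.from T-∧ (p , q)

T-∧ˡ : ∀ a {b} → T (a ∧ b) → T a
T-∧ˡ true  _ = tt

T-∧ʳ : ∀ a {b} → T (a ∧ b) → T b
T-∧ʳ true  p = p

if-congᵀ : ∀ b {x y : ℤ} → (T b → x ≡ y) → (if b then x else + 0) ≡ (if b then y else + 0)
if-congᵀ true  f = f tt
if-congᵀ false f = refl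

if-≡0 : ∀ b {x : ℤ} → (T b → x ≡ + 0) → (if b then x else + 0) ≡ + 0
if-≡0 true  f = f tt
if-≡0 false f = refl

eqℤᵇ⇒≡ : ∀ i j → T (eqℤᵇ i j) → i ≡ j
eqℤᵇ⇒≡ (+ m)    (+ n)    p = cong +_ (ℕ.≡ᵇ⇒≡ m n p)
eqℤᵇ⇒≡ -[1+ m ] -[1+ n ] p = cong -[1+_] (ℕ.≡ᵇ⇒≡ m n p)

eqℤᵇ-refl : ∀ i → T (eqℤᵇ i i)
eqℤᵇ-refl (+ m)    = ℕ.≡⇒≡ᵇ m m refl
eqℤᵇ-refl -[1+ m ] = ℕ.≡⇒≡ᵇ m m refl

≡⇒eqℤᵇ : ∀ {i j} → i ≡ j → T (eqℤᵇ i j)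
≡⇒eqℤᵇ {i} refl = eqℤᵇ-refl i

-- Exponent lists

infix 4 _≐_
-- Lists that differ by trailing zeros denote the same monomial, so exponents are compared by
-- lookup; this is the relation that `eqExps` decides.
record _≐_ (as bs : List ℕ) : Set where
  constructor mk≐
  field at : ∀ i → lookupExp as i ≡ lookupExp bs i
open _≐_ public

≐-refl : ∀ {as} → as ≐ as
≐-refl = mk≐ λ _ → refl

≐-sym : ∀ {as bs} → as ≐ bs → bs ≐ as
≐-sym p = mk≐ λ i → sym (at p i)

≐-trans : ∀ {as bs cs} → as ≐ bs → bs ≐ cs → as ≐ cs
≐-trans p q = mk≐ λ i → trans (at p i) (at q i)

∷-≐ : ∀ {a b as bs} → a ≡ b → as ≐ bs → (a ∷ as) ≐ (b ∷ bs)
∷-≐ a≡b as≐bs = mk≐ λ { zero → a≡b ; (suc i) → at as≐bs i }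

[]-∷-≐ : ∀ {b bs} → b ≡ 0 → [] ≐ bs → [] ≐ (b ∷ bs)
[]-∷-≐ b≡0 []≐bs = mk≐ λ { zero → sym b≡0 ; (suc i) → at []≐bs i }

≐-tail : ∀ {a b as bs} → (a ∷ as) ≐ (b ∷ bs) → as ≐ bs
≐-tail p = mk≐ (at p ∘ suc)

[]-≐-tail : ∀ {b bs} → [] ≐ (b ∷ bs) → [] ≐ bs
[]-≐-tail p = mk≐ (at p ∘ suc)

eqExps⇒≐ : ∀ as bs → T (eqExps as bs) → as ≐ bs
eqExps⇒≐ []       []       p = ≐-refl
eqExps⇒≐ []       (b ∷ bs) p = []-∷-≐ (ℕ.≡ᵇ⇒≡ b 0 (T-∧ˡ (b ≡ᵇ 0) p)) (eqExps⇒≐ [] bs (T-∧ʳ (b ≡ᵇ 0) p))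
eqExps⇒≐ (a ∷ as) []       p = ≐-sym
  ([]-∷-≐ (ℕ.≡ᵇ⇒≡ a 0 (T-∧ˡ (a ≡ᵇ 0) p)) (≐-sym (eqExps⇒≐ as [] (T-∧ʳ (a ≡ᵇ 0) p))))
eqExps⇒≐ (a ∷ as) (b ∷ bs) p =
  ∷-≐ (ℕ.≡ᵇ⇒≡ a b (T-∧ˡ (a ≡ᵇ b) p)) (eqExps⇒≐ as bs (T-∧ʳ (a ≡ᵇ b) p))

≐⇒eqExps : ∀ as bs → as ≐ bs → T (eqExps as bs)
≐⇒eqExps []       []       p = tt
≐⇒eqExps []       (b ∷ bs) p = ∧-T (ℕ.≡⇒≡ᵇ b 0 (sym (at p 0))) (≐⇒eqExps [] bs ([]-≐-tail p))
≐⇒eqExps (a ∷ as) []       p = ∧-T (ℕ.≡⇒≡ᵇ a 0 (at p 0)) (≐⇒eqExps as [] (≐-sym ([]-≐-tail (≐-sym p))))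
≐⇒eqExps (a ∷ as) (b ∷ bs) p = ∧-T (ℕ.≡⇒≡ᵇ a b (at p 0)) (≐⇒eqExps as bs (≐-tail p))

eqExps-ext : ∀ as bs cs ds → (as ≐ bs → cs ≐ ds) → (cs ≐ ds → as ≐ bs) →
             eqExps as bs ≡ eqExps cs ds
eqExps-ext as bs cs ds f g = T-ext
  (λ p → ≐⇒eqExps cs ds (f (eqExps⇒≐ as bs p)))
  (λ p → ≐⇒eqExps as bs (g (eqExps⇒≐ cs ds p)))

lookup-addExps : ∀ as bs i → lookupExp (addExps as bs) i ≡ lookupExp as i ℕ.+ lookupExp bs i
lookup-addExps []       bs       i       = refl
lookup-addExps (a ∷ as) []       i       = sym (ℕ.+-identityʳ _)
lookup-addExps (a ∷ as) (b ∷ bs) zero    = refl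
lookup-addExps (a ∷ as) (b ∷ bs) (suc i) = lookup-addExps as bs i

addExps-identityʳ : ∀ as → addExps as [] ≡ as
addExps-identityʳ []       = refl
addExps-identityʳ (a ∷ as) = refl

addExps-comm : ∀ as bs → addExps as bs ≡ addExps bs as
addExps-comm []       bs       = sym (addExps-identityʳ bs)
addExps-comm (a ∷ as) []       = refl
addExps-comm (a ∷ as) (b ∷ bs) = cong₂ _∷_ (ℕ.+-comm a b) (addExps-comm as bs)

addExps-assoc : ∀ as bs cs → addExps (addExps as bs) cs ≡ addExps as (addExps bs cs)
addExps-assoc []       bs       cs       = refl
addExps-assoc (a ∷ as) []       cs       = refl
addExps-assoc (a ∷ as) (b ∷ bs) []       = refl
addExps-assoc (a ∷ as) (b ∷ bs) (c ∷ cs) = cong₂ _∷_ (ℕ.+-assoc a b c) (addExps-assoc as bs cs)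

subExps : List ℕ → List ℕ → List ℕ
subExps []       bs       = []
subExps (a ∷ as) []       = a ∷ as
subExps (a ∷ as) (b ∷ bs) = a ∸ b ∷ subExps as bs

lookup-subExps : ∀ as bs i → lookupExp (subExps as bs) i ≡ lookupExp as i ∸ lookupExp bs i
lookup-subExps []       bs       i       = sym (ℕ.0∸n≡0 (lookupExp bs i))
lookup-subExps (a ∷ as) []       i       = refl
lookup-subExps (a ∷ as) (b ∷ bs) zero    = refl
lookup-subExps (a ∷ as) (b ∷ bs) (suc i) = lookup-subExps as bs i

-- A witness `cs` of divisibility forces `bs` to lie below `as` entrywise, so the truncated
-- subtraction is exact. Divisibility of monomials can thus be decided by testing the single
-- candidate `subExps as bs`.
addExps-subExps : ∀ as bs cs → addExps bs cs ≐ as → addExps bs (subExps as bs) ≐ as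
addExps-subExps as bs cs p = mk≐ λ i →
  trans (lookup-addExps bs (subExps as bs) i)
    (trans (cong (lookupExp bs i ℕ.+_) (lookup-subExps as bs i)) (ℕ.m+[n∸m]≡n (b≤a i)))
  where
  b≤a : ∀ i → lookupExp bs i ≤ lookupExp as i
  b≤a i = ℕ.≤-trans (ℕ.m≤m+n _ (lookupExp cs i))
            (ℕ.≤-reflexive (trans (sym (lookup-addExps bs cs i)) (at p i)))

addExps-cancelˡ : ∀ as bs cs → addExps as bs ≐ addExps as cs → bs ≐ cs
addExps-cancelˡ as bs cs p = mk≐ λ i → ℕ.+-cancelˡ-≡ (lookupExp as i) _ _
  (trans (sym (lookup-addExps as bs i)) (trans (at p i) (lookup-addExps as cs i)))

addExps-congˡ : ∀ as bs cs → bs ≐ cs → addExps as bs ≐ addExps as cs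
addExps-congˡ as bs cs p = mk≐ λ i → trans (lookup-addExps as bs i)
  (trans (cong (lookupExp as i ℕ.+_) (at p i)) (sym (lookup-addExps as cs i)))

lookup-unitExps : ∀ i m → lookupExp (unitExps i m) i ≡ m
lookup-unitExps zero    m = refl
lookup-unitExps (suc i) m = lookup-unitExps i m

lookup-unitExps-≢ : ∀ i j m → i ≢ j → lookupExp (unitExps i m) j ≡ 0
lookup-unitExps-≢ zero    zero    m i≢j = contradiction refl i≢j
lookup-unitExps-≢ zero    (suc j) m i≢j = refl
lookup-unitExps-≢ (suc i) zero    m i≢j = refl
lookup-unitExps-≢ (suc i) (suc j) m i≢j = lookup-unitExps-≢ i j m (i≢j ∘ cong suc)

lookup-decExp : ∀ as i → lookupExp (decExp as i) i ≡ lookupExp as i ∸ 1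
lookup-decExp []       i       = refl
lookup-decExp (a ∷ as) zero    = refl
lookup-decExp (a ∷ as) (suc i) = lookup-decExp as i

lookup-decExp-≢ : ∀ as i j → i ≢ j → lookupExp (decExp as i) j ≡ lookupExp as j
lookup-decExp-≢ []       i       j       i≢j = refl
lookup-decExp-≢ (a ∷ as) zero    zero    i≢j = contradiction refl i≢j
lookup-decExp-≢ (a ∷ as) zero    (suc j) i≢j = refl
lookup-decExp-≢ (a ∷ as) (suc i) zero    i≢j = refl
lookup-decExp-≢ (a ∷ as) (suc i) (suc j) i≢j = lookup-decExp-≢ as i j (i≢j ∘ cong suc)

addExps-unit-decExp : ∀ as i → lookupExp as i ≢ 0 → addExps (unitExps i 1) (decExp as i) ≐ as
addExps-unit-decExp as i aᵢ≢0 = mk≐ pointwise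
  where
  pointwise : ∀ j → lookupExp (addExps (unitExps i 1) (decExp as i)) j ≡ lookupExp as j
  pointwise j with i ℕ.≟ j
  ... | yes refl = trans (lookup-addExps (unitExps i 1) _ i)
    (trans (cong₂ ℕ._+_ (lookup-unitExps i 1) (lookup-decExp as i)) (ℕ.m+[n∸m]≡n (ℕ.n≢0⇒n>0 aᵢ≢0)))
  ... | no i≢j = trans (lookup-addExps (unitExps i 1) _ j)
    (cong₂ ℕ._+_ (lookup-unitExps-≢ i j 1 i≢j) (lookup-decExp-≢ as i j i≢j))

lookup-unit-addExps : ∀ i as → lookupExp (addExps (unitExps i 1) as) i ≡ suc (lookupExp as i)
lookup-unit-addExps i as =
  trans (lookup-addExps (unitExps i 1) as i) (cong (ℕ._+ lookupExp as i) (lookup-unitExps i 1))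

decExp-addExps-unit : ∀ as i bs → as ≐ addExps (unitExps i 1) bs → decExp as i ≐ bs
decExp-addExps-unit as i bs p = addExps-cancelˡ (unitExps i 1) _ _
  (≐-trans (addExps-unit-decExp as i λ aᵢ≡0 →
    contradiction (trans (sym (lookup-unit-addExps i bs)) (trans (sym (at p i)) aᵢ≡0)) λ ()) p)

-- Coefficients

coeffTerm : Term → ℤ → List ℕ → ℤ
coeffTerm (term c f bs) e as = if eqℤᵇ f e ∧ eqExps bs as then c else + 0

coeff-++ : ∀ p q e as → coeff (p ++ q) e as ≡ coeff p e as ℤ.+ coeff q e as
coeff-++ []      q e as = sym (ℤ.+-identityˡ _)
coeff-++ (s ∷ p) q e as = trans
  (cong₂ ℤ._+_ (refl {x = coeffTerm s e as}) (coeff-++ p q e as)) (sym (ℤ.+-assoc (coeffTerm s e as) _ _))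

coeff-resp-≐ : ∀ p e {as bs} → as ≐ bs → coeff p e as ≡ coeff p e bs
coeff-resp-≐ []                e as≐bs = refl
coeff-resp-≐ (term c f cs ∷ p) e {as} {bs} as≐bs = cong₂ ℤ._+_
  (cong (λ b → if eqℤᵇ f e ∧ b then c else + 0)
    (eqExps-ext cs as cs bs (λ r → ≐-trans r as≐bs) (λ r → ≐-trans r (≐-sym as≐bs))))
  (coeff-resp-≐ p e as≐bs)

-- Multiplication by a term and partial differentiation act term by term. The point is that the
-- factor `w` depends on the target monomial only, never on the term `t`, so it can be taken out of
-- the sum.
coeff-map : ∀ (h : Term → Term) w e as e′ as′ →
            (∀ t → coeffTerm (h t) e as ≡ w ℤ.* coeffTerm t e′ as′) →
            ∀ p → coeff (map h p) e as ≡ w ℤ.* coeff p e′ as′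
coeff-map h w e as e′ as′ eq []      = sym (ℤ.*-zeroʳ w)
coeff-map h w e as e′ as′ eq (t ∷ p) = trans
  (cong₂ ℤ._+_ (eq t) (coeff-map h w e as e′ as′ eq p)) (sym (ℤ.*-distribˡ-+ w (coeffTerm t e′ as′) _))

*-if : ∀ w b c → w ℤ.* (if b then c else + 0) ≡ (if b then w ℤ.* c else + 0)
*-if w true  c = refl
*-if w false c = ℤ.*-zeroʳ w

coeff-mulTerm : ∀ c f bs as q e →
                coeff (map (mulTerm (term c f bs)) q) e (addExps bs as) ≡ c ℤ.* coeff q (e ℤ.- f) as
coeff-mulTerm c f bs as q e = coeff-map _ c e (addExps bs as) (e ℤ.- f) as contribution q
  where
  contribution : ∀ t → coeffTerm (mulTerm (term c f bs) t) e (addExps bs as) ≡ c ℤ.* coeffTerm t (e ℤ.- f) as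
  contribution (term d g cs) = trans
    (cong (λ b → if b then c ℤ.* d else + 0) (cong₂ _∧_
      (T-ext (λ p → ≡⇒eqℤᵇ (shift₁ (eqℤᵇ⇒≡ (f ℤ.+ g) e p)))
             (λ p → ≡⇒eqℤᵇ (shift₂ (eqℤᵇ⇒≡ g (e ℤ.- f) p))))
      (eqExps-ext (addExps bs cs) (addExps bs as) cs as
        (addExps-cancelˡ bs cs as) (addExps-congˡ bs cs as))))
    (sym (*-if c (eqℤᵇ g (e ℤ.- f) ∧ eqExps cs as) d))
    where
    open +-*-Solver
    shift₁ : f ℤ.+ g ≡ e → g ≡ e ℤ.- f
    shift₁ refl = solve 2 (λ f g → g := f :+ g :- f) refl f g
    shift₂ : g ≡ e ℤ.- f → f ℤ.+ g ≡ e
    shift₂ refl = solve 2 (λ e f → f :+ (e :- f) := e) refl e f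

coeff-mulTerm-∤ : ∀ c f bs as q e → (∀ cs → ¬ addExps bs cs ≐ as) →
                  coeff (map (mulTerm (term c f bs)) q) e as ≡ + 0
coeff-mulTerm-∤ c f bs as q e ∤ = coeff-map _ (+ 0) e as e as contribution q
  where
  contribution : ∀ t → coeffTerm (mulTerm (term c f bs) t) e as ≡ + 0 ℤ.* coeffTerm t e as
  contribution (term d g cs) = if-≡0 (eqℤᵇ (f ℤ.+ g) e ∧ eqExps (addExps bs cs) as) λ p →
    contradiction (eqExps⇒≐ _ as (T-∧ʳ (eqℤᵇ (f ℤ.+ g) e) p)) (∤ cs)

-- The relation _≈_ of Defs is a function type, from which the polynomials
-- cannot be inferred; as a record they can.
infix 4 _≋_
record _≋_ (p q : Poly) : Set where
  constructor mk≋
  field coeffs : p ≈ q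
open _≋_

-- The commutative semiring of polynomials

≡⇒≋ : ∀ {p q} → p ≡ q → p ≋ q
≡⇒≋ refl = mk≋ λ _ _ → refl

≋-refl : ∀ {p} → p ≋ p
≋-refl = ≡⇒≋ refl

≋-sym : ∀ {p q} → p ≋ q → q ≋ p
≋-sym (mk≋ p≈q) = mk≋ λ e as → sym (p≈q e as)

≋-trans : ∀ {p q r} → p ≋ q → q ≋ r → p ≋ r
≋-trans (mk≋ p≈q) (mk≋ q≈r) = mk≋ λ e as → trans (p≈q e as) (q≈r e as)

∷-cong : ∀ {s t p q} → (s ∷ []) ≋ (t ∷ []) → p ≋ q → (s ∷ p) ≋ (t ∷ q)
∷-cong {s} {t} (mk≋ s≈t) (mk≋ p≈q) = mk≋ λ e as → cong₂ ℤ._+_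
  (trans (sym (ℤ.+-identityʳ (coeffTerm s e as))) (trans (s≈t e as) (ℤ.+-identityʳ (coeffTerm t e as)))) (p≈q e as)

+R-cong : ∀ {p p′ q q′} → p ≋ p′ → q ≋ q′ → p +R q ≋ p′ +R q′
+R-cong {p} {p′} {q} {q′} (mk≋ p≈p′) (mk≋ q≈q′) = mk≋ λ e as → trans (coeff-++ p q e as)
  (trans (cong₂ ℤ._+_ (p≈p′ e as) (q≈q′ e as)) (sym (coeff-++ p′ q′ e as)))

+R-comm : ∀ p q → p +R q ≋ q +R p
+R-comm p q = mk≋ λ e as → trans (coeff-++ p q e as)
  (trans (ℤ.+-comm (coeff p e as) _) (sym (coeff-++ q p e as)))

mulTerm-comm : ∀ s t → mulTerm s t ≡ mulTerm t s
mulTerm-comm (term c e as) (term d f bs)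
  rewrite ℤ.*-comm c d | ℤ.+-comm e f | addExps-comm as bs = refl

mulTerm-assoc : ∀ s t u → mulTerm (mulTerm s t) u ≡ mulTerm s (mulTerm t u)
mulTerm-assoc (term c e as) (term d f bs) (term b g cs)
  rewrite ℤ.*-assoc c d b | ℤ.+-assoc e f g | addExps-assoc as bs cs = refl

mulTerm-identityˡ : ∀ t → mulTerm (term (+ 1) (+ 0) []) t ≡ t
mulTerm-identityˡ (term c e as) rewrite ℤ.*-identityˡ c | ℤ.+-identityˡ e = refl

-- A coefficient of the product is either `c` times the coefficient at the quotient monomial or,
-- without divisibility, zero. In both cases it depends on the coefficients of the other factor
-- alone.
map-mulTerm-cong : ∀ s {p q} → p ≋ q → map (mulTerm s) p ≋ map (mulTerm s) q
map-mulTerm-cong (term c f bs) {p} {q} (mk≋ p≈q) = mk≋ go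
  where
  go : map (mulTerm (term c f bs)) p ≈ map (mulTerm (term c f bs)) q
  go e as with eqExps (addExps bs (subExps as bs)) as in eq
  ... | true = trans (shifted p) (trans (cong (c ℤ.*_) (p≈q _ _)) (sym (shifted q)))
    where
    as≐ : addExps bs (subExps as bs) ≐ as
    as≐ = eqExps⇒≐ _ as (subst T (sym eq) tt)
    shifted : ∀ r → coeff (map (mulTerm (term c f bs)) r) e as ≡ c ℤ.* coeff r (e ℤ.- f) (subExps as bs)
    shifted r = trans (coeff-resp-≐ (map (mulTerm (term c f bs)) r) e (≐-sym as≐))
      (coeff-mulTerm c f bs (subExps as bs) r e)
  ... | false = trans (coeff-mulTerm-∤ c f bs as p e ∤) (sym (coeff-mulTerm-∤ c f bs as q e ∤))
    where
    ∤ : ∀ cs → ¬ addExps bs cs ≐ as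
    ∤ cs r = subst T eq (≐⇒eqExps _ as (addExps-subExps as bs cs r))

*R-congˡ : ∀ p {q q′} → q ≋ q′ → p *R q ≋ p *R q′
*R-congˡ []      q≋q′ = ≋-refl
*R-congˡ (s ∷ p) q≋q′ = +R-cong (map-mulTerm-cong s q≋q′) (*R-congˡ p q≋q′)

*R-zeroʳ : ∀ p → p *R [] ≡ []
*R-zeroʳ []      = refl
*R-zeroʳ (s ∷ p) = *R-zeroʳ p

+R-swap : ∀ p q r → p +R (q +R r) ≋ q +R (p +R r)
+R-swap p q r = ≋-trans (≡⇒≋ (sym (++-assoc p q r)))
  (≋-trans (+R-cong (+R-comm p q) ≋-refl) (≡⇒≋ (++-assoc q p r)))

*R-∷ʳ : ∀ p t q → p *R (t ∷ q) ≋ map (mulTerm t) p +R p *R q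
*R-∷ʳ []      t q = ≋-refl
*R-∷ʳ (s ∷ p) t q = ∷-cong (≡⇒≋ (cong (_∷ []) (mulTerm-comm s t)))
  (≋-trans (+R-cong ≋-refl (*R-∷ʳ p t q)) (+R-swap (map (mulTerm s) q) (map (mulTerm t) p) (p *R q)))

*R-comm : ∀ p q → p *R q ≋ q *R p
*R-comm p []      = ≡⇒≋ (*R-zeroʳ p)
*R-comm p (t ∷ q) = ≋-trans (*R-∷ʳ p t q) (+R-cong ≋-refl (*R-comm p q))

map-mulTerm-*R : ∀ s p q → map (mulTerm s) p *R q ≡ map (mulTerm s) (p *R q)
map-mulTerm-*R s []      q = refl
map-mulTerm-*R s (t ∷ p) q = trans
  (cong₂ _++_ (trans (map-cong (mulTerm-assoc s t) q) (map-∘ q)) (map-mulTerm-*R s p q))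
  (sym (map-++ (mulTerm s) (map (mulTerm t) q) (p *R q)))

*R-distribʳ : ∀ r p q → (p +R q) *R r ≡ p *R r +R q *R r
*R-distribʳ r p q = concatMap-++ (λ s → map (mulTerm s) r) p q

*R-assoc : ∀ p q r → (p *R q) *R r ≡ p *R (q *R r)
*R-assoc []      q r = refl
*R-assoc (s ∷ p) q r = trans (*R-distribʳ r (map (mulTerm s) q) (p *R q))
  (cong₂ _++_ (map-mulTerm-*R s q r) (*R-assoc p q r))

*R-identityˡ : ∀ p → 1R *R p ≡ p
*R-identityˡ p = trans (++-identityʳ _) (trans (map-cong mulTerm-identityˡ p) (map-id p))

-- Signs occur only inside integer coefficients and exponents, so no polynomial is ever negated and
-- a semiring solver can do the rearrangements.
polySemiring : CommutativeSemiring 0ℓ 0ℓ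
polySemiring = record
  { Carrier = Poly ; _≈_ = _≋_ ; _+_ = _+R_ ; _*_ = _*R_ ; 0# = 0R ; 1# = 1R
  ; isCommutativeSemiring = isCommutativeSemiringˡ record
    { +-isCommutativeMonoid = record
      { isMonoid = record
        { isSemigroup = record
          { isMagma = record
            { isEquivalence = record { refl = ≋-refl ; sym = ≋-sym ; trans = ≋-trans }
            ; ∙-cong = +R-cong }
          ; assoc = λ p q r → ≡⇒≋ (++-assoc p q r) }
        ; identity = (λ _ → ≋-refl) , λ p → ≡⇒≋ (++-identityʳ p) }
      ; comm = +R-comm }
    ; *-isCommutativeMonoid = record
      { isMonoid = record
        { isSemigroup = record
          { isMagma = record
            { isEquivalence = record { refl = ≋-refl ; sym = ≋-sym ; trans = ≋-trans }
            ; ∙-cong = λ {p} {p′} {q} {q′} p≋p′ q≋q′ → ≋-trans (*R-congˡ p q≋q′)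
                (≋-trans (*R-comm p q′) (≋-trans (*R-congˡ q′ p≋p′) (*R-comm q′ p′))) }
          ; assoc = λ p q r → ≡⇒≋ (*R-assoc p q r) }
        ; identity = (λ p → ≡⇒≋ (*R-identityˡ p)) ,
            λ p → ≋-trans (*R-comm p 1R) (≡⇒≋ (*R-identityˡ p)) }
      ; comm = *R-comm }
    ; distribʳ = λ r p q → ≡⇒≋ (*R-distribʳ r p q)
    ; zeroˡ = λ _ → ≋-refl } }

module R = CommutativeSemiring polySemiring
module ≋-Reasoning = SetoidReasoning R.setoid
open Derivations polySemiring
module Sumℕ = Derivations ℕ.+-*-commutativeSemiring

-- Single terms and partial derivatives

term-resp-≐ : ∀ c e {as bs} → as ≐ bs → (term c e as ∷ []) ≋ (term c e bs ∷ [])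
term-resp-≐ c e {as} {bs} as≐bs = mk≋ λ f cs → cong (λ b → (if eqℤᵇ e f ∧ b then c else + 0) ℤ.+ + 0)
  (eqExps-ext as cs bs cs (≐-trans (≐-sym as≐bs)) (≐-trans as≐bs))

term-0 : ∀ {c} e as → c ≡ + 0 → (term c e as ∷ []) ≋ 0R
term-0 e as refl = mk≋ λ f bs → trans (ℤ.+-identityʳ _) (if-≡0 (eqℤᵇ e f ∧ eqExps as bs) λ _ → refl)

term-+ : ∀ c d e as → (term (c ℤ.+ d) e as ∷ []) ≋ (term c e as ∷ term d e as ∷ [])
term-+ c d e as = mk≋ λ f bs → go (eqℤᵇ e f ∧ eqExps as bs)
  where
  go : ∀ b → (if b then c ℤ.+ d else + 0) ℤ.+ + 0 ≡
             (if b then c else + 0) ℤ.+ ((if b then d else + 0) ℤ.+ + 0)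
  go true  = ℤ.+-assoc c d (+ 0)
  go false = refl

-- A named form of the anonymous functions that `∂` maps over a polynomial. The index is shifted:
-- `∂Term i` belongs to X_{i+1}.
∂Term : ℕ → Term → Term
∂Term zero    (term c e as) = term (c ℤ.* e) (e ℤ.- + 1) as
∂Term (suc i) (term c e as) = term (c ℤ.* + lookupExp as i) e (decExp as i)

∂≡map : ∀ i p → ∂ (suc i) p ≡ map (∂Term i) p
∂≡map zero    p = map-cong (λ _ → refl) p
∂≡map (suc i) p = map-cong (λ _ → refl) p

coeff-∂-X₁ : ∀ p e as → coeff (∂ 1 p) e as ≡ (e ℤ.+ + 1) ℤ.* coeff p (e ℤ.+ + 1) as
coeff-∂-X₁ p e as = coeff-map _ (e ℤ.+ + 1) e as (e ℤ.+ + 1) as contribution p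
  where
  open +-*-Solver
  shift₁ : ∀ f → f ℤ.- + 1 ≡ e → f ≡ e ℤ.+ + 1
  shift₁ f refl = solve 1 (λ f → f := f :- con (+ 1) :+ con (+ 1)) refl f
  shift₂ : ∀ f → f ≡ e ℤ.+ + 1 → f ℤ.- + 1 ≡ e
  shift₂ f refl = solve 1 (λ e → e :+ con (+ 1) :- con (+ 1) := e) refl e
  contribution : ∀ t → coeffTerm (∂Term 0 t) e as ≡ (e ℤ.+ + 1) ℤ.* coeffTerm t (e ℤ.+ + 1) as
  contribution (term c f bs) = trans
    (cong (λ b → if b ∧ eqExps bs as then c ℤ.* f else + 0)
      (T-ext (λ p → ≡⇒eqℤᵇ (shift₁ f (eqℤᵇ⇒≡ _ e p))) (λ p → ≡⇒eqℤᵇ (shift₂ f (eqℤᵇ⇒≡ f _ p)))))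
    (trans
      (if-congᵀ (eqℤᵇ f (e ℤ.+ + 1) ∧ eqExps bs as) λ p →
        trans (ℤ.*-comm c f) (cong (ℤ._* c) (eqℤᵇ⇒≡ f _ (T-∧ˡ (eqℤᵇ f (e ℤ.+ + 1)) p))))
      (sym (*-if (e ℤ.+ + 1) (eqℤᵇ f (e ℤ.+ + 1) ∧ eqExps bs as) c)))

coeff-∂ : ∀ i p e as →
          coeff (∂ (suc (suc i)) p) e as ≡ + suc (lookupExp as i) ℤ.* coeff p e (addExps (unitExps i 1) as)
coeff-∂ i p e as = coeff-map _ (+ suc (lookupExp as i)) e as e as⁺ contribution p
  where
  as⁺ = addExps (unitExps i 1) as
  contribution : ∀ t → coeffTerm (∂Term (suc i) t) e as ≡ + suc (lookupExp as i) ℤ.* coeffTerm t e as⁺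
  contribution (term c f bs) = trans (exps (eqExps bs as⁺) refl)
    (sym (*-if (+ suc (lookupExp as i)) (eqℤᵇ f e ∧ eqExps bs as⁺) c))
    where
    exps : ∀ b → eqExps bs as⁺ ≡ b →
           (if eqℤᵇ f e ∧ eqExps (decExp bs i) as then c ℤ.* + lookupExp bs i else + 0) ≡
           (if eqℤᵇ f e ∧ b then + suc (lookupExp as i) ℤ.* c else + 0)
    exps true eq = trans
      (cong (λ x → if eqℤᵇ f e ∧ x then c ℤ.* + lookupExp bs i else + 0)
        (T-ext {b = true} (λ _ → tt) (λ _ → ≐⇒eqExps _ as (decExp-addExps-unit bs i as bs≐as⁺))))
      (cong (λ x → if eqℤᵇ f e ∧ true then x else + 0)
        (trans (ℤ.*-comm c _) (cong (λ x → + x ℤ.* c) (trans (at bs≐as⁺ i) (lookup-unit-addExps i as)))))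
      where
      bs≐as⁺ : bs ≐ as⁺
      bs≐as⁺ = eqExps⇒≐ bs as⁺ (subst T (sym eq) tt)
    -- `decExp` truncates at 0, so a term other than `as⁺` may land on `as`; its exponent at `i` is
    -- then 0, and this exponent is a factor of the new coefficient.
    exps false eq = trans
      (if-≡0 (eqℤᵇ f e ∧ eqExps (decExp bs i) as) λ p →
        trans (cong (λ x → c ℤ.* + x) (bsᵢ≡0 (eqExps⇒≐ _ as (T-∧ʳ (eqℤᵇ f e) p)))) (ℤ.*-zeroʳ c))
      (sym (if-≡0 (eqℤᵇ f e ∧ false) λ p → ⊥-elim (T-∧ʳ (eqℤᵇ f e) p)))
      where
      bsᵢ≡0 : decExp bs i ≐ as → lookupExp bs i ≡ 0
      bsᵢ≡0 p with lookupExp bs i ℕ.≟ 0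
      ... | yes bsᵢ≡0 = bsᵢ≡0
      ... | no  bsᵢ≢0 = ⊥-elim (subst T eq (≐⇒eqExps bs as⁺
        (≐-trans (≐-sym (addExps-unit-decExp bs i bsᵢ≢0)) (addExps-congˡ (unitExps i 1) _ as p))))

-- The coefficient formulas express a derivative through the coefficients of its argument, which the
-- map over terms does not show.
∂-cong : ∀ i {p q} → p ≋ q → ∂ (suc i) p ≋ ∂ (suc i) q
∂-cong zero {p} {q} (mk≋ p≈q) = mk≋ λ e as →
  trans (coeff-∂-X₁ p e as) (trans (cong ((e ℤ.+ + 1) ℤ.*_) (p≈q _ as)) (sym (coeff-∂-X₁ q e as)))
∂-cong (suc i) {p} {q} (mk≋ p≈q) = mk≋ λ e as →
  trans (coeff-∂ i p e as) (trans (cong (+ suc (lookupExp as i) ℤ.*_) (p≈q e _)) (sym (coeff-∂ i q e as)))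

∂-++ : ∀ i p q → ∂ (suc i) (p +R q) ≡ ∂ (suc i) p +R ∂ (suc i) q
∂-++ zero    p q = map-++ _ p q
∂-++ (suc i) p q = map-++ _ p q

∂Term-mulTerm : ∀ i s t →
  (∂Term i (mulTerm s t) ∷ []) ≋ (mulTerm (∂Term i s) t ∷ mulTerm s (∂Term i t) ∷ [])
∂Term-mulTerm zero (term c e as) (term d f bs) = begin
  term (c ℤ.* d ℤ.* (e ℤ.+ f)) (e ℤ.+ f ℤ.- + 1) cs ∷ []
    ≡⟨ cong (λ x → term x _ cs ∷ []) (solve 4 (λ c d e f → c :* d :* (e :+ f) := c :* e :* d :+ c :* (d :* f)) refl c d e f) ⟩
  term (c ℤ.* e ℤ.* d ℤ.+ c ℤ.* (d ℤ.* f)) (e ℤ.+ f ℤ.- + 1) cs ∷ []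
    ≈⟨ term-+ _ _ _ cs ⟩
  term (c ℤ.* e ℤ.* d) (e ℤ.+ f ℤ.- + 1) cs ∷ term (c ℤ.* (d ℤ.* f)) (e ℤ.+ f ℤ.- + 1) cs ∷ []
    ≡⟨ cong₂ (λ x y → term _ x cs ∷ term _ y cs ∷ [])
         (solve 2 (λ e f → e :+ f :- con (+ 1) := e :- con (+ 1) :+ f) refl e f)
         (ℤ.+-assoc e f _) ⟩
  term (c ℤ.* e ℤ.* d) (e ℤ.- + 1 ℤ.+ f) cs ∷ term (c ℤ.* (d ℤ.* f)) (e ℤ.+ (f ℤ.- + 1)) cs ∷ [] ∎
  where
  open ≋-Reasoning
  cs = addExps as bs
  open +-*-Solver using (solve; _:*_; _:+_; _:-_; _:=_; con)
∂Term-mulTerm (suc i) (term c e as) (term d f bs) = begin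
  term (c ℤ.* d ℤ.* + lookupExp (addExps as bs) i) g cs ∷ []
    ≡⟨ cong (λ x → term x g cs ∷ []) coefs ⟩
  term (c ℤ.* + a ℤ.* d ℤ.+ c ℤ.* (d ℤ.* + b)) g cs ∷ []
    ≈⟨ term-+ _ _ g cs ⟩
  term (c ℤ.* + a ℤ.* d) g cs ∷ term (c ℤ.* (d ℤ.* + b)) g cs ∷ []
    ≈⟨ ∷-cong
         (decrement as bs λ a≡0 → trans (cong (λ x → c ℤ.* + x ℤ.* d) a≡0) (cong (ℤ._* d) (ℤ.*-zeroʳ c)))
         (≋-trans (≡⇒≋ (cong (λ x → term _ g (decExp x i) ∷ []) (addExps-comm as bs)))
           (≋-trans (decrement bs as λ b≡0 → trans (cong (λ x → c ℤ.* (d ℤ.* + x)) b≡0) (trans (cong (c ℤ.*_) (ℤ.*-zeroʳ d)) (ℤ.*-zeroʳ c)))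
             (≡⇒≋ (cong (λ x → term _ g x ∷ []) (addExps-comm (decExp bs i) as))))) ⟩
  term (c ℤ.* + a ℤ.* d) g (addExps (decExp as i) bs) ∷ term (c ℤ.* (d ℤ.* + b)) g (addExps as (decExp bs i)) ∷ [] ∎
  where
  open ≋-Reasoning
  a = lookupExp as i
  b = lookupExp bs i
  g = e ℤ.+ f
  cs = decExp (addExps as bs) i
  coefs : c ℤ.* d ℤ.* + lookupExp (addExps as bs) i ≡ c ℤ.* + a ℤ.* d ℤ.+ c ℤ.* (d ℤ.* + b)
  coefs = trans (cong (λ x → c ℤ.* d ℤ.* x) (trans (cong +_ (lookup-addExps as bs i)) (ℤ.pos-+ a b)))
    (solve 4 (λ c d e f → c :* d :* (e :+ f) := c :* e :* d :+ c :* (d :* f)) refl c d (+ a) (+ b))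
    where open +-*-Solver using (solve; _:*_; _:+_; _:=_)
  -- Decrementing the product and decrementing one factor agree unless the exponent in that factor
  -- is 0, where truncation interferes; there the coefficient `x` vanishes.
  decrement : ∀ {x} as bs → (lookupExp as i ≡ 0 → x ≡ + 0) →
    (term x g (decExp (addExps as bs) i) ∷ []) ≋ (term x g (addExps (decExp as i) bs) ∷ [])
  decrement {x} as bs x≡0 with lookupExp as i ℕ.≟ 0
  ... | yes aᵢ≡0 = ≋-trans (term-0 g _ (x≡0 aᵢ≡0)) (≋-sym (term-0 g _ (x≡0 aᵢ≡0)))
  ... | no  aᵢ≢0 = term-resp-≐ x g (decExp-addExps-unit _ i _ (≐-trans
    (subst₂′ (addExps-comm bs as) (addExps-comm bs (addExps (unitExps i 1) (decExp as i)))
      (addExps-congˡ bs _ _ (≐-sym (addExps-unit-decExp as i aᵢ≢0))))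
    (mk≐ λ j → cong (λ x → lookupExp x j) (addExps-assoc (unitExps i 1) (decExp as i) bs))))
    where
    subst₂′ : ∀ {as as′ bs bs′} → as ≡ as′ → bs ≡ bs′ → as ≐ bs → as′ ≐ bs′
    subst₂′ refl refl p = p

∂-map-mulTerm : ∀ i s q →
  ∂ (suc i) (map (mulTerm s) q) ≋ map (mulTerm (∂Term i s)) q +R map (mulTerm s) (∂ (suc i) q)
∂-map-mulTerm i s q = begin
  ∂ (suc i) (map (mulTerm s) q)                                           ≡⟨ ∂≡map i _ ⟩
  map (∂Term i) (map (mulTerm s) q)                                       ≈⟨ go q ⟩
  map (mulTerm (∂Term i s)) q +R map (mulTerm s) (map (∂Term i) q)        ≡⟨ cong (λ p → map (mulTerm (∂Term i s)) q +R map (mulTerm s) p) (∂≡map i q) ⟨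
  map (mulTerm (∂Term i s)) q +R map (mulTerm s) (∂ (suc i) q)            ∎
  where
  open ≋-Reasoning
  go : ∀ q → map (∂Term i) (map (mulTerm s) q) ≋
             map (mulTerm (∂Term i s)) q +R map (mulTerm s) (map (∂Term i) q)
  go []      = ≋-refl
  go (t ∷ q) = begin
    (∂Term i (mulTerm s t) ∷ []) +R map (∂Term i) (map (mulTerm s) q)
      ≈⟨ +R-cong (∂Term-mulTerm i s t) (go q) ⟩
    (mulTerm (∂Term i s) t ∷ []) +R ((mulTerm s (∂Term i t) ∷ []) +R
      (map (mulTerm (∂Term i s)) q +R map (mulTerm s) (map (∂Term i) q)))
      ≈⟨ R.+-congˡ {mulTerm (∂Term i s) t ∷ []}
           (+R-swap (mulTerm s (∂Term i t) ∷ []) (map (mulTerm (∂Term i s)) q) _) ⟩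
    map (mulTerm (∂Term i s)) (t ∷ q) +R map (mulTerm s) (map (∂Term i) (t ∷ q)) ∎

∂-*R : ∀ i p q → ∂ (suc i) (p *R q) ≋ ∂ (suc i) p *R q +R p *R ∂ (suc i) q
∂-*R i []      q = ≡⇒≋ (trans (∂≡map i []) (sym (cong (λ p → p *R q +R []) (∂≡map i []))))
∂-*R i (s ∷ p) q = begin
  ∂ (suc i) (map (mulTerm s) q +R p *R q)
    ≡⟨ ∂-++ i (map (mulTerm s) q) (p *R q) ⟩
  ∂ (suc i) (map (mulTerm s) q) +R ∂ (suc i) (p *R q)
    ≈⟨ +R-cong (∂-map-mulTerm i s q) (∂-*R i p q) ⟩
  (map (mulTerm (∂Term i s)) q +R map (mulTerm s) (∂ (suc i) q)) +R (∂ (suc i) p *R q +R p *R ∂ (suc i) q)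
    ≈⟨ interchange (map (mulTerm (∂Term i s)) q) (map (mulTerm s) (∂ (suc i) q)) _ _ ⟩
  (map (mulTerm (∂Term i s)) q +R ∂ (suc i) p *R q) +R (s ∷ p) *R ∂ (suc i) q
    ≡⟨ cong (λ r → r *R q +R (s ∷ p) *R ∂ (suc i) q)
         (trans (cong (∂Term i s ∷_) (∂≡map i p)) (sym (∂≡map i (s ∷ p)))) ⟩
  ∂ (suc i) (s ∷ p) *R q +R (s ∷ p) *R ∂ (suc i) q ∎
  where
  open ≋-Reasoning
  open import Algebra.Properties.CommutativeSemigroup R.+-commutativeSemigroup using (interchange)

∂-isDerivation : ∀ i → IsDerivation (∂ (suc i))
∂-isDerivation i = record
  { d-cong = ∂-cong i
  ; d-0#   = ≡⇒≋ (∂≡map i [])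
  ; d-1#   = ≋-trans (≡⇒≋ (∂≡map i 1R)) (∂1 i)
  ; d-+    = λ p q → ≡⇒≋ (∂-++ i p q)
  ; d-*    = ∂-*R i }
  where
  ∂1 : ∀ i → map (∂Term i) 1R ≋ 0R
  ∂1 zero    = term-0 _ _ refl
  ∂1 (suc i) = term-0 _ _ refl

decExp-comm : ∀ as i j → decExp (decExp as i) j ≡ decExp (decExp as j) i
decExp-comm []       i       j       = refl
decExp-comm (a ∷ as) zero    zero    = refl
decExp-comm (a ∷ as) zero    (suc j) = refl
decExp-comm (a ∷ as) (suc i) zero    = refl
decExp-comm (a ∷ as) (suc i) (suc j) = cong (a ∷_) (decExp-comm as i j)

open import Algebra.Properties.CommutativeSemigroup ℤ.*-commutativeSemigroup using (xy∙z≈xz∙y)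

∂Term-comm : ∀ i j t → ∂Term i (∂Term j t) ≡ ∂Term j (∂Term i t)
∂Term-comm zero    zero    t = refl
∂Term-comm zero    (suc j) (term c e as) = cong (λ x → term x _ _) (xy∙z≈xz∙y c _ e)
∂Term-comm (suc i) zero    t = sym (∂Term-comm zero (suc i) t)
∂Term-comm (suc i) (suc j) (term c e as) with i ℕ.≟ j
... | yes refl = refl
... | no  i≢j  = cong₂ (λ x y → term x e y)
  (trans (cong (λ x → c ℤ.* + lookupExp as j ℤ.* + x) (lookup-decExp-≢ as j i (i≢j ∘ sym)))
    (trans (xy∙z≈xz∙y c (+ lookupExp as j) (+ lookupExp as i))
      (cong (λ x → c ℤ.* + lookupExp as i ℤ.* + x) (sym (lookup-decExp-≢ as i j i≢j)))))
  (decExp-comm as j i)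

-- Needed in `∂-S`: a derivative known to kill S_{n,k+1} is moved past the one that occurs in the
-- recurrence.
∂-comm : ∀ i j p → ∂ (suc i) (∂ (suc j) p) ≡ ∂ (suc j) (∂ (suc i) p)
∂-comm i j p = trans (unfold i j) (trans (map-cong (∂Term-comm i j) p) (sym (unfold j i)))
  where
  unfold : ∀ i j → ∂ (suc i) (∂ (suc j) p) ≡ map (∂Term i ∘ ∂Term j) p
  unfold i j = trans (∂≡map i _) (trans (cong (map (∂Term i)) (∂≡map j p)) (sym (map-∘ p)))

∂-X-≢ : ∀ i j → i ≢ j → ∂ (suc i) (X (suc j)) ≋ 0R
∂-X-≢ zero    zero    i≢j = contradiction refl i≢j
∂-X-≢ zero    (suc j) i≢j = term-0 _ _ refl
∂-X-≢ (suc i) zero    i≢j = term-0 _ _ refl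
∂-X-≢ (suc i) (suc j) i≢j = term-0 _ _
  (cong (λ x → + 1 ℤ.* + x) (lookup-unitExps-≢ j i 1 (λ j≡i → i≢j (cong suc (sym j≡i)))))

-- The derivation ∑ⱼ X_{j+1} ∂/∂X_j, truncated at j = N.
D : ℕ → Poly → Poly
D N p = ∑ N (λ i → X (suc (suc i)) *R ∂ (suc i) p)

D-isDerivation : ∀ N → IsDerivation (D N)
D-isDerivation N = ∑-isDerivation N (λ i → X (suc (suc i))) ∂-isDerivation

sumFromTo≡∑ : ∀ a b f → sumFromTo a b f ≡ ∑ (suc b ∸ a) (λ i → f (a ℕ.+ i))
sumFromTo≡∑ a b f = trans unfold (recursion partialSum refl (λ _ → refl) (suc b ∸ a))
  where
  -- Solved by the local function go of sumFromTo, which cannot be named here.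
  partialSum : ℕ → Poly
  partialSum = _
  unfold : sumFromTo a b f ≡ partialSum (suc b ∸ a)
  unfold with suc b ∸ a
  ... | m = refl
  recursion : ∀ (g : ℕ → Poly) → g 0 ≡ 0R → (∀ m → g (suc m) ≡ g m +R f (a ℕ.+ m)) →
              ∀ m → g m ≡ ∑ m (λ i → f (a ℕ.+ i))
  recursion g g₀ gₛ zero    = g₀
  recursion g g₀ gₛ (suc m) = trans (gₛ m) (cong (_+R f (a ℕ.+ m)) (recursion g g₀ gₛ m))

-- The multivariate Stirling polynomials

const : ℤ → Poly
const c = term c (+ 0) [] ∷ []

scale≡const : ∀ c p → scale c p ≡ const c *R p
scale≡const c p = sym (trans (++-identityʳ _)
  (map-cong (λ { (term d e as) → cong (λ f → term (c ℤ.* d) f as) (ℤ.+-identityˡ e) }) p))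

-- Both the exponent of X_1 in A_{n,k} and the coefficient of X_2 in the recurrence of S. That these
-- coincide is what makes `A-suc` work.
κ : ℕ → ℤ
κ n = ℤ.- (+ (2 ℕ.* n) ℤ.- + 1)

<⇒<ᵇ≡true : ∀ {m n} → m < n → (m ℕ.<ᵇ n) ≡ true
<⇒<ᵇ≡true {m} {n} m<n with m ℕ.<ᵇ n | ℕ.<⇒<ᵇ m<n
... | true | _ = refl

S-lower : ∀ {n k} → n < k → S n k ≡ 0R
S-lower {zero}  {suc k} n<k = refl
S-lower {suc n} {suc k} (s≤s n<k) with n ℕ.<ᵇ k | <⇒<ᵇ≡true n<k
... | true | _ = refl

S-suc-≤ : ∀ {n k} → k ≤ n → S (suc n) (suc k) ≡
          const (κ n) *R (X 2 *R S n (suc k)) +R X 1 *R (S n k +R D (n ∸ k) (S n (suc k)))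
S-suc-≤ {n} {k} k≤n with n ℕ.<ᵇ k in eq
... | true  = contradiction (ℕ.<ᵇ⇒< n k (subst T (sym eq) tt)) (ℕ.≤⇒≯ k≤n)
... | false = cong₂ (λ p q → p +R X 1 *R (S n k +R q))
  (scale≡const (κ n) (X 2 *R S n (suc k))) (sumFromTo≡∑ 1 (n ∸ k) _)

∂-const : ∀ i c → ∂ (suc i) (const c) ≋ 0R
∂-const zero    c = term-0 _ _ (ℤ.*-zeroʳ c)
∂-const (suc i) c = term-0 _ _ (ℤ.*-zeroʳ c)

-- That is, S_{n,k} involves no variable beyond X_{n-k+1}. By induction along the recurrence: its
-- only new variables are X_1, X_2 and the X_{j+1} with j up to the upper limit of its sum.
∂-S : ∀ n k i → n < i ℕ.+ k → ∂ (suc i) (S n k) ≋ 0R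
∂-S zero    zero    (suc i) n<i+k = term-0 _ _ refl
∂-S zero    (suc k) i       n<i+k = IsDerivation.d-0# (∂-isDerivation i)
∂-S (suc n) zero    i       n<i+k = IsDerivation.d-0# (∂-isDerivation i)
∂-S (suc n) (suc k) i       n<i+k with n ℕ.<? k
... | yes n<k = ≋-trans (≡⇒≋ (cong (∂ (suc i)) (S-lower (s≤s n<k)))) (IsDerivation.d-0# (∂-isDerivation i))
... | no  n≮k = ≋-trans (≡⇒≋ (cong (∂ (suc i)) (S-suc-≤ k≤n))) (d-+-zero
    (d-*-zero (∂-const i (κ n)) X₂S)
    (d-*-zero (∂-X-≢ i 0 i≢0)
      (d-+-zero (∂-S n k i n<i+k′)
        (≋-trans (d-∑ (n ∸ k) _) (∑-zero (n ∸ k) XᵢdS)))))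
  where
  open IsDerivation (∂-isDerivation i)
  k≤n : k ≤ n
  k≤n = ℕ.≮⇒≥ n≮k
  n<i+k′ : n < i ℕ.+ k
  n<i+k′ = ℕ.≤-pred (ℕ.≤-trans n<i+k (ℕ.≤-reflexive (ℕ.+-suc i k)))
  n<i+1+k : n < i ℕ.+ suc k
  n<i+1+k = ℕ.<-trans (ℕ.n<1+n n) n<i+k
  i≢0 : i ≢ 0
  i≢0 refl = n≮k n<i+k′
  X₂S : ∂ (suc i) (X 2 *R S n (suc k)) ≋ 0R
  X₂S with i ℕ.≟ 1
  ... | no  i≢1  = d-*-zero (∂-X-≢ i 1 i≢1) (∂-S n (suc k) i n<i+1+k)
  -- The factor X_2 is not killed when i = 1, but then n < k + 1, so the other factor is zero.
  ... | yes refl rewrite S-lower {n} {suc k} n<i+k′ = d-0#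
  XᵢdS : ∀ j → j < n ∸ k → ∂ (suc i) (X (suc (suc j)) *R ∂ (suc j) (S n (suc k))) ≋ 0R
  XᵢdS j j<n∸k = d-*-zero (∂-X-≢ i (suc j) i≢1+j)
    (≋-trans (≡⇒≋ (∂-comm i j (S n (suc k))))
      (≋-trans (∂-cong j (∂-S n (suc k) i n<i+1+k)) (IsDerivation.d-0# (∂-isDerivation j))))
    where
    -- The bounds give j + 1 ≤ n - k < i.
    i≢1+j : i ≢ suc j
    i≢1+j refl = ℕ.<⇒≱ n<i+k′ (ℕ.≤-trans (ℕ.+-monoˡ-≤ k j<n∸k) (ℕ.≤-reflexive (ℕ.m∸n+n≡m k≤n)))

-- By `∂-S` the additional summands of `D N` vanish, and for n < k both sides are zero. The
-- recurrence thereby loses its case distinction and its varying upper limit.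
S-suc : ∀ {n N} k → n ≤ N → S (suc n) (suc k) ≋
        const (κ n) *R (X 2 *R S n (suc k)) +R X 1 *R (S n k +R D N (S n (suc k)))
S-suc {n} {N} k n≤N with n ℕ.<? k
... | no n≮k = ≋-trans (≡⇒≋ (S-suc-≤ (ℕ.≮⇒≥ n≮k)))
  (R.+-congˡ {const (κ n) *R (X 2 *R S n (suc k))} (R.*-congˡ {X 1} (R.+-congˡ {S n k} (∑-extend (ℕ.≤-trans (ℕ.m∸n≤m n k) n≤N) _ λ i n∸k≤i →
    ≋-trans (R.*-congˡ {X (suc (suc i))} (∂-S n (suc k) i (bound i n∸k≤i))) (R.zeroʳ (X (suc (suc i))))))))
  where
  bound : ∀ i → n ∸ k ≤ i → n < i ℕ.+ suc k
  bound i n∸k≤i = ℕ.≤-trans (s≤s (ℕ.≤-trans (ℕ.m≤n+m∸n n k)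
    (ℕ.≤-trans (ℕ.+-monoʳ-≤ k n∸k≤i) (ℕ.≤-reflexive (ℕ.+-comm k i))))) (ℕ.≤-reflexive (sym (ℕ.+-suc i k)))
... | yes n<k
  rewrite S-lower {suc n} {suc k} (s≤s n<k) | S-lower n<k | S-lower (ℕ.m<n⇒m<1+n n<k) =
  ≋-sym (≋-trans (R.+-cong
    (≋-trans (R.*-congˡ {const (κ n)} (R.zeroʳ (X 2))) (R.zeroʳ (const (κ n))))
    (≋-trans (R.*-congˡ {X 1} (IsDerivation.d-0# (D-isDerivation N))) (R.zeroʳ (X 1))))
    (R.+-identityˡ 0R))

-- Only X_2 ∂/∂X_1 contributes, hence the truncation at `suc N`. The power X_1^{a-1} is left as a
-- product so as to match the expression reached in `A-suc`.
D-X₁^ : ∀ N a → D (suc N) (X₁^ a) ≋ const a *R (X 2 *R (X₁^ (ℤ.- + 1) *R X₁^ a))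
D-X₁^ N a = begin
  D (suc N) (X₁^ a)
    ≈⟨ ∑-head N _ ⟩
  X 2 *R ∂ 1 (X₁^ a) +R ∑ N (λ i → X (3 ℕ.+ i) *R ∂ (2 ℕ.+ i) (X₁^ a))
    ≈⟨ R.+-congˡ {X 2 *R ∂ 1 (X₁^ a)} (∑-zero N λ i _ →
         ≋-trans (R.*-congˡ {X (3 ℕ.+ i)} (term-0 a [] refl)) (R.zeroʳ (X (3 ℕ.+ i)))) ⟩
  X 2 *R ∂ 1 (X₁^ a) +R 0R
    ≡⟨ cong (λ t → t ∷ []) (cong₂ (λ c e → term c e (1 ∷ []))
         (solve 1 (λ a → con (+ 1) :* (con (+ 1) :* a) := a :* con (+ 1)) refl a)
         (solve 1 (λ a → con (+ 0) :+ (a :- con (+ 1)) := con (+ 0) :+ (con (+ 0) :+ (con -1ℤ :+ a))) refl a)) ⟩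
  const a *R (X 2 *R (X₁^ (ℤ.- + 1) *R X₁^ a)) ∎
  where
  open ≋-Reasoning
  open +-*-Solver

-- Write X_1^{κ(n+1)} as X_1⁻² X_1^{κ(n)}. The X_2 term of the recurrence for S then becomes X_1⁻¹
-- D(X_1^{κ(n)}) S_{n,k+1}, which is the missing half of the Leibniz rule for D(X_1^{κ(n)}
-- S_{n,k+1}). This uses the summand j = 1 of D, whence `0 < N`.
A-suc : ∀ {n N} k → n ≤ N → 0 < N →
        A (suc n) (suc k) ≋ X₁^ (ℤ.- + 1) *R A n k +R X₁^ (ℤ.- + 1) *R D N (A n (suc k))
A-suc {n} {suc N} k n≤N _ = begin
  X₁^ (κ (suc n)) *R S (suc n) (suc k)
    ≈⟨ R.*-cong power (S-suc k n≤N) ⟩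
  (y *R (y *R v)) *R (c *R (X 2 *R s) +R x *R (r +R Ds))
    ≈⟨ expand y v c (X 2) s x r Ds ⟩
  y *R ((x *R y) *R (v *R r)) +R y *R ((c *R (X 2 *R (y *R v))) *R s +R (x *R y) *R (v *R Ds))
    -- The product of X_1 and X_1⁻¹ evaluates to `1R`.
    ≡⟨⟩
  y *R (1R *R (v *R r)) +R y *R ((c *R (X 2 *R (y *R v))) *R s +R 1R *R (v *R Ds))
    ≈⟨ R.+-cong (R.*-congˡ {y} (R.*-identityˡ (v *R r)))
         (R.*-congˡ {y} (R.+-cong (R.*-congʳ {s} (≋-sym (D-X₁^ N (κ n)))) (R.*-identityˡ (v *R Ds)))) ⟩
  y *R (v *R r) +R y *R (D (suc N) v *R s +R v *R Ds)
    ≈⟨ R.+-congˡ {y *R (v *R r)} (R.*-congˡ {y} (IsDerivation.d-* (D-isDerivation (suc N)) v s)) ⟨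
  y *R A n k +R y *R D (suc N) (A n (suc k)) ∎
  where
  open ≋-Reasoning
  x y v c s r Ds : Poly
  x = X 1
  y = X₁^ (ℤ.- + 1)
  v = X₁^ (κ n)
  c = const (κ n)
  s = S n (suc k)
  r = S n k
  Ds = D (suc N) (S n (suc k))
  power : X₁^ (κ (suc n)) ≋ y *R (y *R v)
  power = ≡⇒≋ (cong X₁^ (trans
    (cong (λ m → ℤ.- (m ℤ.- + 1)) (trans (cong +_ (ℕ.*-suc 2 n)) (ℤ.pos-+ 2 (2 ℕ.* n))))
    (solve 1 (λ m → :- (con (+ 2) :+ m :- con (+ 1)) := con -1ℤ :+ (con -1ℤ :+ :- (m :- con (+ 1)))) refl (+ (2 ℕ.* n)))))
    where open +-*-Solver
  expand : ∀ y v c z s x r d →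
    (y *R (y *R v)) *R (c *R (z *R s) +R x *R (r +R d)) ≋
    y *R ((x *R y) *R (v *R r)) +R y *R ((c *R (z *R (y *R v))) *R s +R (x *R y) *R (v *R d))
  expand = solve 8 (λ y v c z s x r d →
      (y :* (y :* v)) :* (c :* (z :* s) :+ x :* (r :+ d)) :=
      y :* ((x :* y) :* (v :* r)) :+ y :* ((c :* (z :* (y :* v))) :* s :+ (x :* y) :* (v :* d))) ≋-refl
    where open import Algebra.Solver.Ring.NaturalCoefficients.Default polySemiring

-- Statistics of exponent lists

-- Insensitivity to trailing zeros need only be checked for a single zero in front of the empty
-- list. The position `i` is carried along because the weights and factorials depend on it.
fold-resp-≐ : ∀ {A : Set} (f : ℕ → List ℕ → A) (h : ℕ → ℕ → A → A) →
              (∀ i r rs → f i (r ∷ rs) ≡ h i r (f (suc i) rs)) →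
              (∀ i → h i 0 (f (suc i) []) ≡ f i []) →
              ∀ i {rs ss} → rs ≐ ss → f i rs ≡ f i ss
fold-resp-≐ f h step unit = go
  where
  empty : ∀ i ss → [] ≐ ss → f i [] ≡ f i ss
  empty i []       p = refl
  empty i (s ∷ ss) p = trans (sym (unit i))
    (trans (cong₂ (h i) (at p 0) (empty (suc i) ss ([]-≐-tail p))) (sym (step i s ss)))
  go : ∀ i {rs ss} → rs ≐ ss → f i rs ≡ f i ss
  go i {[]}     {ss}     p = empty i ss p
  go i {r ∷ rs} {[]}     p = sym (empty i (r ∷ rs) (≐-sym p))
  go i {r ∷ rs} {s ∷ ss} p = trans (step i r rs)
    (trans (cong₂ (h i) (at p 0) (go (suc i) (≐-tail p))) (sym (step i s ss)))

sumR-resp-≐ : ∀ {rs ss} → rs ≐ ss → sumR rs ≡ sumR ss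
sumR-resp-≐ = fold-resp-≐ (λ _ → sumR) (λ _ → ℕ._+_) (λ _ _ _ → refl) (λ _ → refl) 0

weightedSum-resp-≐ : ∀ i {rs ss} → rs ≐ ss → weightedSum i rs ≡ weightedSum i ss
weightedSum-resp-≐ = fold-resp-≐ weightedSum (λ i r x → i ℕ.* r ℕ.+ x) (λ _ _ _ → refl)
  (λ i → trans (ℕ.+-identityʳ _) (ℕ.*-zeroʳ i))

denom-resp-≐ : ∀ i {rs ss} → rs ≐ ss → denom i rs ≡ denom i ss
denom-resp-≐ = fold-resp-≐ denom (λ i r x → (r !) ℕ.* ((i !) ℕ.^ r) ℕ.* x) (λ _ _ _ → refl) (λ _ → refl)

isSol-resp-≐ : ∀ n k {rs ss} → rs ≐ ss → isSol n k rs ≡ isSol n k ss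
isSol-resp-≐ n k p = cong₂ (λ s w → (s ≡ᵇ k) ∧ (w ≡ᵇ n)) (sumR-resp-≐ p) (weightedSum-resp-≐ 1 p)

sumR-unit : ∀ j rs → sumR (addExps (unitExps j 1) rs) ≡ suc (sumR rs)
sumR-unit zero    []       = refl
sumR-unit zero    (r ∷ rs) = refl
sumR-unit (suc j) []       = trans (cong sumR (sym (addExps-identityʳ (unitExps j 1)))) (sumR-unit j [])
sumR-unit (suc j) (r ∷ rs) = trans (cong (r ℕ.+_) (sumR-unit j rs)) (ℕ.+-suc r _)

weightedSum-unit : ∀ i j rs → weightedSum i (addExps (unitExps j 1) rs) ≡ i ℕ.+ j ℕ.+ weightedSum i rs
weightedSum-unit i zero    []       = solve 1 (λ i → i :* con 1 :+ con 0 := i :+ con 0 :+ con 0) refl i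
  where open ℕSolver.+-*-Solver
weightedSum-unit i zero    (r ∷ rs) = solve 3
  (λ i r w → i :* (con 1 :+ r) :+ w := i :+ con 0 :+ (i :* r :+ w)) refl i r (weightedSum (suc i) rs)
  where open ℕSolver.+-*-Solver
weightedSum-unit i (suc j) [] = trans
  (cong₂ ℕ._+_ (ℕ.*-zeroʳ i) (trans (cong (weightedSum (suc i)) (sym (addExps-identityʳ (unitExps j 1))))
    (weightedSum-unit (suc i) j [])))
  (cong (ℕ._+ 0) (sym (ℕ.+-suc i j)))
weightedSum-unit i (suc j) (r ∷ rs) = trans (cong (i ℕ.* r ℕ.+_) (weightedSum-unit (suc i) j rs))
  (solve 4 (λ i j r w → i :* r :+ (con 1 :+ i :+ j :+ w) := i :+ (con 1 :+ j) :+ (i :* r :+ w)) refl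
    i j r (weightedSum (suc i) rs))
  where open ℕSolver.+-*-Solver

-- Raising r_j by one turns r_j! into (r_j + 1)! and adds one factor (i + j)!. These ratios are all
-- that the recurrence of B uses about denominators.
denom-unit : ∀ i j rs →
             denom i (addExps (unitExps j 1) rs) ≡ suc (lookupExp rs j) ℕ.* (i ℕ.+ j) ! ℕ.* denom i rs
denom-unit i zero [] rewrite ℕ.+-identityʳ i =
  solve 1 (λ f → con 1 :* (f :* con 1) :* con 1 := con 1 :* f :* con 1) refl (i !)
  where open ℕSolver.+-*-Solver
denom-unit i zero (r ∷ rs) rewrite ℕ.+-identityʳ i =
  solve 5 (λ r f g p d → (con 1 :+ r) :* f :* (g :* p) :* d := (con 1 :+ r) :* g :* (f :* p :* d)) refl
    r (r !) (i !) ((i !) ℕ.^ r) (denom (suc i) rs)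
  where open ℕSolver.+-*-Solver
denom-unit i (suc j) [] = trans (ℕ.*-identityˡ (denom (suc i) (unitExps j 1)))
  (trans (cong (denom (suc i)) (sym (addExps-identityʳ (unitExps j 1))))
    (trans (denom-unit (suc i) j []) (cong (λ m → 1 ℕ.* m ! ℕ.* 1) (sym (ℕ.+-suc i j)))))
denom-unit i (suc j) (r ∷ rs) = trans
  (cong ((r !) ℕ.* ((i !) ℕ.^ r) ℕ.*_) (trans (denom-unit (suc i) j rs)
    (cong (λ m → suc (lookupExp rs j) ℕ.* m ! ℕ.* denom (suc i) rs) (sym (ℕ.+-suc i j)))))
  (solve 4 (λ a b c d → a :* (b :* c :* d) := b :* c :* (a :* d)) refl
    ((r !) ℕ.* ((i !) ℕ.^ r)) (suc (lookupExp rs j)) ((i ℕ.+ suc j) !) (denom (suc i) rs))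
  where open ℕSolver.+-*-Solver

denom-nonZero : ∀ i rs → ℕ.NonZero (denom i rs)
denom-nonZero i []       = _
denom-nonZero i (r ∷ rs) = ℕ.m*n≢0 _ _ {{ℕ.m*n≢0 (r !) _ {{r ℕ.!≢0}} {{ℕ.m^n≢0 (i !) r {{i ℕ.!≢0}}}}}}
  {{denom-nonZero (suc i) rs}}

sumR≤weightedSum : ∀ i rs → sumR rs ≤ weightedSum (suc i) rs
sumR≤weightedSum i []       = z≤n
sumR≤weightedSum i (r ∷ rs) = ℕ.+-mono-≤ (ℕ.m≤m+n r _) (sumR≤weightedSum (suc i) rs)

lookup≤sumR : ∀ rs i → lookupExp rs i ≤ sumR rs
lookup≤sumR []       i       = z≤n
lookup≤sumR (r ∷ rs) zero    = ℕ.m≤m+n r _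
lookup≤sumR (r ∷ rs) (suc i) = ℕ.≤-trans (lookup≤sumR rs i) (ℕ.m≤n+m _ r)

-- A nonzero entry at a position j ≥ M would alone contribute at least i + M, which the bound
-- forbids. So the truncation of D still sees the entire weighted sum.
weightedSum≡∑ : ∀ i rs M → weightedSum i rs < i ℕ.+ M →
                weightedSum i rs ≡ Sumℕ.∑ M (λ j → (i ℕ.+ j) ℕ.* lookupExp rs j)
weightedSum≡∑ i []       M       w<i+M = sym (Sumℕ.∑-zero M λ j _ → ℕ.*-zeroʳ (i ℕ.+ j))
weightedSum≡∑ i (suc r ∷ rs) zero w<i+M = contradiction w<i+M (ℕ.≤⇒≯ (ℕ.≤-trans
  (ℕ.≤-reflexive (ℕ.+-identityʳ i)) (ℕ.≤-trans (ℕ.m≤m*n i (suc r)) (ℕ.m≤m+n _ _))))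
weightedSum≡∑ i (zero ∷ rs) zero w<i+M = trans (cong (ℕ._+ weightedSum (suc i) rs) (ℕ.*-zeroʳ i))
  (weightedSum≡∑ (suc i) rs zero (ℕ.m<n⇒m<1+n (ℕ.≤-<-trans (ℕ.m≤n+m _ (i ℕ.* 0)) w<i+M)))
weightedSum≡∑ i (r ∷ rs) (suc M) w<i+M = trans
  (cong₂ ℕ._+_ (cong (ℕ._* r) (sym (ℕ.+-identityʳ i)))
    (trans (weightedSum≡∑ (suc i) rs M (ℕ.<-≤-trans (ℕ.≤-<-trans (ℕ.m≤n+m _ (i ℕ.* r)) w<i+M)
        (ℕ.≤-reflexive (ℕ.+-suc i M))))
      (Sumℕ.∑-cong M λ j _ → cong (ℕ._* lookupExp rs j) (sym (ℕ.+-suc i j)))))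
  (sym (Sumℕ.∑-head M _))

-- Coefficients at monomials with nonnegative exponents

-- Rejoins the exponent of X_1, which polynomials store separately, with the others, giving the
-- indexing of the r_i in the Bell formula.
coeffAt : Poly → List ℕ → ℤ
coeffAt p rs = coeff p (+ lookupExp rs 0) (drop 1 rs)

drop-≐ : ∀ {rs ss} → rs ≐ ss → drop 1 rs ≐ drop 1 ss
drop-≐ {[]}     {[]}     p = ≐-refl
drop-≐ {[]}     {s ∷ ss} p = []-≐-tail p
drop-≐ {r ∷ rs} {[]}     p = ≐-sym ([]-≐-tail (≐-sym p))
drop-≐ {r ∷ rs} {s ∷ ss} p = ≐-tail p

coeffAt-resp-≐ : ∀ p {rs ss} → rs ≐ ss → coeffAt p rs ≡ coeffAt p ss
coeffAt-resp-≐ p {rs} {ss} rs≐ss = trans (cong (λ e → coeff p (+ e) (drop 1 rs)) (at rs≐ss 0))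
  (coeff-resp-≐ p _ (drop-≐ rs≐ss))

coeff-monomial-*R : ∀ t p e as → coeff ((t ∷ []) *R p) e as ≡ coeff (map (mulTerm t) p) e as
coeff-monomial-*R t p e as = cong (λ q → coeff q e as) (++-identityʳ (map (mulTerm t) p))

coeff-X₁ : ∀ p e as → coeff (X 1 *R p) e as ≡ coeff p (e ℤ.- + 1) as
coeff-X₁ p e as = trans (coeff-monomial-*R (term (+ 1) (+ 1) []) p e as)
  (trans (coeff-mulTerm (+ 1) (+ 1) [] as p e) (ℤ.*-identityˡ _))

coeff-X : ∀ i p e as → lookupExp as i ≢ 0 →
          coeff (X (suc (suc i)) *R p) e as ≡ coeff p e (decExp as i)
coeff-X i p e as aᵢ≢0 = trans (coeff-monomial-*R (term (+ 1) (+ 0) (unitExps i 1)) p e as)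
  (trans (coeff-resp-≐ (map (mulTerm (term (+ 1) (+ 0) (unitExps i 1))) p) e (≐-sym (addExps-unit-decExp as i aᵢ≢0)))
    (trans (coeff-mulTerm (+ 1) (+ 0) (unitExps i 1) (decExp as i) p e)
      (trans (ℤ.*-identityˡ _) (cong (λ f → coeff p f (decExp as i)) (ℤ.+-identityʳ e)))))

coeff-X-zero : ∀ i p e as → lookupExp as i ≡ 0 → coeff (X (suc (suc i)) *R p) e as ≡ + 0
coeff-X-zero i p e as aᵢ≡0 = trans (coeff-monomial-*R (term (+ 1) (+ 0) (unitExps i 1)) p e as)
  (coeff-mulTerm-∤ (+ 1) (+ 0) (unitExps i 1) as p e λ cs u+cs≐as →
    contradiction (trans (sym (lookup-unit-addExps i cs)) (trans (at u+cs≐as i) aᵢ≡0)) λ ())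

coeffAt-X : ∀ i p rs → lookupExp rs i ≢ 0 → coeffAt (X (suc i) *R p) rs ≡ coeffAt p (decExp rs i)
coeffAt-X i       p []           rᵢ≢0 = contradiction refl rᵢ≢0
coeffAt-X zero    p (zero ∷ as)  rᵢ≢0 = contradiction refl rᵢ≢0
coeffAt-X zero    p (suc r ∷ as) rᵢ≢0 = coeff-X₁ p (+ suc r) as
coeffAt-X (suc i) p (r ∷ as)     rᵢ≢0 = coeff-X i p (+ r) as rᵢ≢0

coeffAt-∂ : ∀ i p rs →
            coeffAt (∂ (suc i) p) rs ≡ + suc (lookupExp rs i) ℤ.* coeffAt p (addExps (unitExps i 1) rs)
coeffAt-∂ zero    p []       = coeff-∂-X₁ p (+ 0) []
coeffAt-∂ zero    p (r ∷ as) = trans (coeff-∂-X₁ p (+ r) as)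
  (cong (λ m → + m ℤ.* coeff p (+ m) as) (ℕ.+-comm r 1))
coeffAt-∂ (suc i) p []       = trans (coeff-∂ i p (+ 0) [])
  (cong (λ as → + 1 ℤ.* coeff p (+ 0) as) (addExps-identityʳ (unitExps i 1)))
coeffAt-∂ (suc i) p (r ∷ as) = coeff-∂ i p (+ r) as

coeff-∑-zero : ∀ N f e as → (∀ i → coeff (f i) e as ≡ + 0) → coeff (∑ N f) e as ≡ + 0
coeff-∑-zero zero    f e as f≡0 = refl
coeff-∑-zero (suc N) f e as f≡0 = trans (coeff-++ (∑ N f) (f N) e as)
  (cong₂ ℤ._+_ (coeff-∑-zero N f e as f≡0) (f≡0 N))

coeffAt-∑ : ∀ N f rs d w (c : ℕ → ℕ) → (∀ i → coeffAt (f i) rs ℤ.* d ≡ + c i ℤ.* w) →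
            coeffAt (∑ N f) rs ℤ.* d ≡ + Sumℕ.∑ N c ℤ.* w
coeffAt-∑ zero    f rs d w c eq = refl
coeffAt-∑ (suc N) f rs d w c eq = begin
  coeffAt (∑ N f +R f N) rs ℤ.* d                  ≡⟨ cong (ℤ._* d) (coeff-++ (∑ N f) (f N) _ _) ⟩
  (coeffAt (∑ N f) rs ℤ.+ coeffAt (f N) rs) ℤ.* d  ≡⟨ ℤ.*-distribʳ-+ d (coeffAt (∑ N f) rs) _ ⟩
  coeffAt (∑ N f) rs ℤ.* d ℤ.+ coeffAt (f N) rs ℤ.* d ≡⟨ cong₂ ℤ._+_ (coeffAt-∑ N f rs d w c eq) (eq N) ⟩
  + Sumℕ.∑ N c ℤ.* w ℤ.+ + c N ℤ.* w               ≡⟨ ℤ.*-distribʳ-+ w (+ Sumℕ.∑ N c) (+ c N) ⟨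
  + Sumℕ.∑ (suc N) c ℤ.* w                         ∎
  where open ≡.≡-Reasoning

-- Bell polynomials

-- Clearing denominators makes the recurrence provable before it is known
-- that the divisions in B are exact; exactness is then a consequence.
record IsBell (n k : ℕ) (p : Poly) : Set where
  field
    negative : ∀ m as → coeff p -[1+ m ] as ≡ + 0
    cleared  : ∀ rs → coeffAt p rs ℤ.* + denom 1 rs ≡ (if isSol n k rs then + (n !) else + 0)
open IsBell

-- The denominators are nonzero and can be cancelled; `negative` covers the exponents of X_1 that
-- `coeffAt` does not reach.
isBell-unique : ∀ {n k p q} → IsBell n k p → IsBell n k q → p ≋ q
isBell-unique bp bq = mk≋ λ
  { (+ r)    as → ℤ.*-cancelʳ-≡ _ _ (+ denom 1 (r ∷ as)) {{denom-nonZero 1 (r ∷ as)}}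
                    (trans (cleared bp (r ∷ as)) (sym (cleared bq (r ∷ as))))
  ; -[1+ m ] as → trans (negative bp m as) (sym (negative bq m as)) }

negative-∂ : ∀ i q → (∀ m as → coeff q -[1+ m ] as ≡ + 0) → ∀ m as → coeff (∂ (suc i) q) -[1+ m ] as ≡ + 0
-- The coefficient at X_1⁻¹ carries the factor -1 + 1 = 0.
negative-∂ zero    q q≡0 zero    as = coeff-∂-X₁ q -[1+ 0 ] as
negative-∂ zero    q q≡0 (suc m) as = trans (coeff-∂-X₁ q -[1+ suc m ] as)
  (trans (cong (-[1+ m ] ℤ.*_) (q≡0 m as)) (ℤ.*-zeroʳ -[1+ m ]))
negative-∂ (suc i) q q≡0 m       as = trans (coeff-∂ i q -[1+ m ] as)
  (trans (cong (+ suc (lookupExp as i) ℤ.*_) (q≡0 m _)) (ℤ.*-zeroʳ (+ suc (lookupExp as i))))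

negative-X : ∀ i q → (∀ m as → coeff q -[1+ m ] as ≡ + 0) → ∀ m as → coeff (X (suc i) *R q) -[1+ m ] as ≡ + 0
negative-X zero    q q≡0 m as = trans (coeff-X₁ q -[1+ m ] as) (q≡0 _ as)
negative-X (suc i) q q≡0 m as with lookupExp as i ℕ.≟ 0
... | yes aᵢ≡0 = coeff-X-zero i q -[1+ m ] as aᵢ≡0
... | no  aᵢ≢0 = trans (coeff-X i q -[1+ m ] as aᵢ≢0) (q≡0 m _)

coeffAt-X-zero : ∀ i q → (∀ m as → coeff q -[1+ m ] as ≡ + 0) → ∀ rs → lookupExp rs i ≡ 0 →
                 coeffAt (X (suc i) *R q) rs ≡ + 0
coeffAt-X-zero zero    q q≡0 []          rᵢ≡0 = trans (coeff-X₁ q (+ 0) []) (q≡0 0 [])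
coeffAt-X-zero zero    q q≡0 (zero ∷ as) rᵢ≡0 = trans (coeff-X₁ q (+ 0) as) (q≡0 0 as)
coeffAt-X-zero (suc i) q q≡0 []          rᵢ≡0 = coeff-X-zero i q (+ 0) [] refl
coeffAt-X-zero (suc i) q q≡0 (r ∷ as)    rᵢ≡0 = coeff-X-zero i q (+ r) as rᵢ≡0

module _ {n k p q} (bp : IsBell n k p) (bq : IsBell n (suc k) q) where

  private
    weight : List ℕ → ℤ
    weight rs = if isSol (suc n) (suc k) rs then + (n !) else + 0

    isSol-unit : ∀ j ss → isSol (suc n) (suc k) (addExps (unitExps j 1) ss) ≡
                          (sumR ss ≡ᵇ k) ∧ (j ℕ.+ weightedSum 1 ss ≡ᵇ n)
    isSol-unit j ss = cong₂ (λ s w → (s ≡ᵇ suc k) ∧ (w ≡ᵇ suc n)) (sumR-unit j ss) (weightedSum-unit 1 j ss)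

    isSol-unit′ : ∀ j ss → isSol n (suc k) (addExps (unitExps j 1) ss) ≡
                           (sumR ss ≡ᵇ k) ∧ (suc j ℕ.+ weightedSum 1 ss ≡ᵇ n)
    isSol-unit′ j ss = cong₂ (λ s w → (s ≡ᵇ suc k) ∧ (w ≡ᵇ n)) (sumR-unit j ss) (weightedSum-unit 1 j ss)

    -- The factor 1 is kept because this is the term i = 0 of the sum of the (i + 1) r_{i+1}
    -- assembled in `isBell-step`.
    X₁-summand : ∀ rs → coeffAt (X 1 *R p) rs ℤ.* + denom 1 rs ≡ + (1 ℕ.* lookupExp rs 0) ℤ.* weight rs
    X₁-summand rs with lookupExp rs 0 ℕ.≟ 0
    ... | yes r₀≡0 = trans (cong (ℤ._* + denom 1 rs) (coeffAt-X-zero 0 p (negative bp) rs r₀≡0))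
      (sym (cong (λ r → + (1 ℕ.* r) ℤ.* weight rs) r₀≡0))
    ... | no  r₀≢0 = begin
      coeffAt (X 1 *R p) rs ℤ.* + denom 1 rs
        ≡⟨ cong₂ (λ c d → c ℤ.* + d) (coeffAt-X 0 p rs r₀≢0)
             (trans (denom-resp-≐ 1 rs≐) (denom-unit 1 0 ss)) ⟩
      C ℤ.* + (suc (lookupExp ss 0) ℕ.* 1 ℕ.* denom 1 ss)
        ≡⟨ cong (λ m → C ℤ.* + m) (cong (ℕ._* denom 1 ss) (ℕ.*-comm (suc (lookupExp ss 0)) 1)) ⟩
      C ℤ.* + (1 ℕ.* suc (lookupExp ss 0) ℕ.* denom 1 ss)
        ≡⟨ cong (C ℤ.*_) (ℤ.pos-* (1 ℕ.* suc (lookupExp ss 0)) (denom 1 ss)) ⟩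
      C ℤ.* (+ (1 ℕ.* suc (lookupExp ss 0)) ℤ.* + denom 1 ss)
        ≡⟨ solve 3 (λ c m d → c :* (m :* d) := m :* (c :* d)) refl C (+ (1 ℕ.* suc (lookupExp ss 0))) (+ denom 1 ss) ⟩
      + (1 ℕ.* suc (lookupExp ss 0)) ℤ.* (C ℤ.* + denom 1 ss)
        ≡⟨ cong₂ (λ r w → + (1 ℕ.* r) ℤ.* w)
             (trans (sym (lookup-unit-addExps 0 ss)) (sym (at rs≐ 0)))
             (trans (cleared bp ss) (cong (λ b → if b then + (n !) else + 0)
               (sym (trans (isSol-resp-≐ (suc n) (suc k) rs≐) (isSol-unit 0 ss))))) ⟩
      + (1 ℕ.* lookupExp rs 0) ℤ.* weight rs ∎
      where
      open ≡.≡-Reasoning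
      open +-*-Solver using (solve; _:*_; _:=_)
      ss = decExp rs 0
      C = coeffAt p ss
      rs≐ : rs ≐ addExps (unitExps 0 1) ss
      rs≐ = ≐-sym (addExps-unit-decExp rs 0 r₀≢0)

    -- The operator trades one X_{i+1} for one X_{i+2}. Let s be the exponent of X_{i+1} before the
    -- trade and s′ that of X_{i+2} after it. Differentiation contributes s, and the two
    -- denominators have ratio (i + 2) s′ / s, so s cancels. The trade keeps the number of factors
    -- and raises the weighted sum by one, so solutions correspond to solutions.
    X∂-summand : ∀ rs i → coeffAt (X (suc (suc i)) *R ∂ (suc i) q) rs ℤ.* + denom 1 rs ≡
                          + (suc (suc i) ℕ.* lookupExp rs (suc i)) ℤ.* weight rs
    X∂-summand rs i with lookupExp rs (suc i) ℕ.≟ 0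
    ... | yes r≡0 = trans
      (cong (ℤ._* + denom 1 rs) (coeffAt-X-zero (suc i) (∂ (suc i) q) (negative-∂ i q (negative bq)) rs r≡0))
      (sym (cong (λ r → + r ℤ.* weight rs) (trans (cong (suc (suc i) ℕ.*_) r≡0) (ℕ.*-zeroʳ (suc (suc i))))))
    ... | no r≢0 = begin
      coeffAt (X (suc (suc i)) *R ∂ (suc i) q) rs ℤ.* + denom 1 rs
        ≡⟨ cong₂ (λ c d → c ℤ.* + d)
             (trans (coeffAt-X (suc i) (∂ (suc i) q) rs r≢0) (coeffAt-∂ i q ss))
             (trans (denom-resp-≐ 1 rs≐) (denom-unit 1 (suc i) ss)) ⟩
      (+ s ℤ.* C) ℤ.* + (s′ ℕ.* (suc (suc i)) ! ℕ.* denom 1 ss)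
        ≡⟨ trans (cong (ℤ._* + (s′ ℕ.* (suc (suc i)) ! ℕ.* denom 1 ss)) (ℤ.*-comm (+ s) C))
             (trans (ℤ.*-assoc C (+ s) _) (cong (C ℤ.*_) (sym (ℤ.pos-* s _)))) ⟩
      C ℤ.* + (s ℕ.* (s′ ℕ.* (suc (suc i)) ! ℕ.* denom 1 ss))
        ≡⟨ cong (λ m → C ℤ.* + m) (regroup s s′ (suc (suc i)) ((suc i) !) (denom 1 ss)) ⟩
      C ℤ.* + (suc (suc i) ℕ.* s′ ℕ.* (s ℕ.* (suc i) ! ℕ.* denom 1 ss))
        ≡⟨ cong (C ℤ.*_) (ℤ.pos-* (suc (suc i) ℕ.* s′) _) ⟩
      C ℤ.* (+ (suc (suc i) ℕ.* s′) ℤ.* + (s ℕ.* (suc i) ! ℕ.* denom 1 ss))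
        ≡⟨ ℤ-regroup C (+ (suc (suc i) ℕ.* s′)) _ ⟩
      + (suc (suc i) ℕ.* s′) ℤ.* (C ℤ.* + (s ℕ.* (suc i) ! ℕ.* denom 1 ss))
        ≡⟨ cong₂ (λ r w → + (suc (suc i) ℕ.* r) ℤ.* w)
             (trans (sym (lookup-unit-addExps (suc i) ss)) (sym (at rs≐ (suc i))))
             (trans (cong (λ d → C ℤ.* + d) (sym (denom-unit 1 i ss)))
               (trans (cleared bq (addExps (unitExps i 1) ss)) (cong (λ b → if b then + (n !) else + 0)
                 (trans (isSol-unit′ i ss)
                   (sym (trans (isSol-resp-≐ (suc n) (suc k) rs≐) (isSol-unit (suc i) ss))))))) ⟩
      + (suc (suc i) ℕ.* lookupExp rs (suc i)) ℤ.* weight rs ∎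
      where
      open ≡.≡-Reasoning
      ss = decExp rs (suc i)
      s = suc (lookupExp ss i)
      s′ = suc (lookupExp ss (suc i))
      C = coeffAt q (addExps (unitExps i 1) ss)
      rs≐ : rs ≐ addExps (unitExps (suc i) 1) ss
      rs≐ = ≐-sym (addExps-unit-decExp rs (suc i) r≢0)
      regroup : ∀ s s′ m f d → s ℕ.* (s′ ℕ.* (m ℕ.* f) ℕ.* d) ≡ m ℕ.* s′ ℕ.* (s ℕ.* f ℕ.* d)
      regroup = solve 5 (λ s s′ m f d → s :* (s′ :* (m :* f) :* d) := m :* s′ :* (s :* f :* d)) refl
        where open ℕSolver.+-*-Solver
      ℤ-regroup : ∀ c m d → c ℤ.* (m ℤ.* d) ≡ m ℤ.* (c ℤ.* d)
      ℤ-regroup = solve 3 (λ c m d → c :* (m :* d) := m :* (c :* d)) refl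
        where open +-*-Solver

  -- The summands contribute the multiples i r_i of n!, and on a solution these multipliers add up
  -- to n + 1, giving (n + 1) n! = (n + 1)!.
  isBell-step : ∀ {N} → n ≤ N → IsBell (suc n) (suc k) (X 1 *R p +R D N q)
  isBell-step {N} n≤N = record
    { negative = λ m as → trans (coeff-++ (X 1 *R p) (D N q) -[1+ m ] as) (cong₂ ℤ._+_
        (negative-X 0 p (negative bp) m as)
        (coeff-∑-zero N _ -[1+ m ] as λ i →
          negative-X (suc i) (∂ (suc i) q) (negative-∂ i q (negative bq)) m as))
    ; cleared = λ rs → begin
        coeffAt (X 1 *R p +R D N q) rs ℤ.* + denom 1 rs
          ≡⟨ trans (cong (ℤ._* + denom 1 rs) (coeff-++ (X 1 *R p) (D N q) _ _))
               (ℤ.*-distribʳ-+ (+ denom 1 rs) (coeffAt (X 1 *R p) rs) _) ⟩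
        coeffAt (X 1 *R p) rs ℤ.* + denom 1 rs ℤ.+ coeffAt (D N q) rs ℤ.* + denom 1 rs
          ≡⟨ cong₂ ℤ._+_ (X₁-summand rs)
               (coeffAt-∑ N _ rs (+ denom 1 rs) (weight rs) _ (X∂-summand rs)) ⟩
        + (1 ℕ.* lookupExp rs 0) ℤ.* weight rs ℤ.+
        + Sumℕ.∑ N (λ i → suc (suc i) ℕ.* lookupExp rs (suc i)) ℤ.* weight rs
          ≡⟨ ℤ.*-distribʳ-+ (weight rs) (+ (1 ℕ.* lookupExp rs 0))
               (+ Sumℕ.∑ N (λ i → suc (suc i) ℕ.* lookupExp rs (suc i))) ⟨
        + (1 ℕ.* lookupExp rs 0 ℕ.+ Sumℕ.∑ N (λ i → suc (suc i) ℕ.* lookupExp rs (suc i))) ℤ.* weight rs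
          ≡⟨ cong (λ m → + m ℤ.* weight rs) (Sumℕ.∑-head N (λ i → suc i ℕ.* lookupExp rs i)) ⟨
        + Sumℕ.∑ (suc N) (λ i → suc i ℕ.* lookupExp rs i) ℤ.* weight rs
          ≡⟨ *-if (+ Sumℕ.∑ (suc N) (λ i → suc i ℕ.* lookupExp rs i)) (isSol (suc n) (suc k) rs) (+ (n !)) ⟩
        (if isSol (suc n) (suc k) rs then + Sumℕ.∑ (suc N) (λ i → suc i ℕ.* lookupExp rs i) ℤ.* + (n !) else + 0)
          ≡⟨ if-congᵀ (isSol (suc n) (suc k) rs) (λ sol → trans (sym (ℤ.pos-* (Sumℕ.∑ (suc N) (λ i → suc i ℕ.* lookupExp rs i)) (n !)))
               (cong (λ m → + (m ℕ.* n !)) (total rs sol))) ⟩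
        (if isSol (suc n) (suc k) rs then + (suc n !) else + 0) ∎ }
    where
    open ≡.≡-Reasoning
    total : ∀ rs → T (isSol (suc n) (suc k) rs) → Sumℕ.∑ (suc N) (λ i → suc i ℕ.* lookupExp rs i) ≡ suc n
    total rs sol = trans
      (sym (weightedSum≡∑ 1 rs (suc N) (ℕ.≤-trans (s≤s (ℕ.≤-reflexive w≡1+n)) (s≤s (s≤s n≤N))))) w≡1+n
      where
      w≡1+n : weightedSum 1 rs ≡ suc n
      w≡1+n = ℕ.≡ᵇ⇒≡ _ _ (T-∧ʳ (sumR rs ≡ᵇ suc k) sol)

-- Boundary entries: row 0, column 0 and k > n

sumR≡0⇒≐[] : ∀ rs → sumR rs ≡ 0 → rs ≐ []
sumR≡0⇒≐[] rs Σ≡0 = mk≐ λ i → ℕ.n≤0⇒n≡0 (ℕ.≤-trans (lookup≤sumR rs i) (ℕ.≤-reflexive Σ≡0))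

isBell-0R : ∀ {n k} → (∀ rs → ¬ T (isSol n k rs)) → IsBell n k 0R
isBell-0R {n} {k} ∄sol = record
  { negative = λ _ _ → refl
  ; cleared = λ rs → sym (if-≡0 (isSol n k rs) λ sol → contradiction sol (∄sol rs)) }

B-lower : ∀ {n k} → n < k → B n k ≡ 0R
B-lower {zero}  {suc k} n<k = refl
B-lower {suc n} {suc k} n<k with suc n ℕ.<ᵇ suc k | <⇒<ᵇ≡true n<k
... | true | _ = refl

-- Every weight is at least 1, so a solution would give k ≤ n.
isBell-lower : ∀ {n k} → n < k → IsBell n k (B n k)
isBell-lower {n} {k} n<k rewrite B-lower n<k = isBell-0R λ rs sol → ℕ.<⇒≱ n<k (ℕ.≤-trans
  (ℕ.≤-reflexive (sym (ℕ.≡ᵇ⇒≡ _ k (T-∧ˡ (sumR rs ≡ᵇ k) sol))))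
  (ℕ.≤-trans (sumR≤weightedSum 0 rs) (ℕ.≤-reflexive (ℕ.≡ᵇ⇒≡ _ n (T-∧ʳ (sumR rs ≡ᵇ k) sol)))))

isBell-column : ∀ n → IsBell (suc n) 0 0R
isBell-column n = isBell-0R λ rs sol → contradiction
  (trans (sym (ℕ.≡ᵇ⇒≡ _ (suc n) (T-∧ʳ (sumR rs ≡ᵇ 0) sol)))
    (weightedSum-resp-≐ 1 (sumR≡0⇒≐[] rs (ℕ.≡ᵇ⇒≡ _ 0 (T-∧ˡ (sumR rs ≡ᵇ 0) sol)))))
  λ ()

isBell-corner : IsBell 0 0 1R
isBell-corner = record { negative = λ _ _ → refl ; cleared = cleared-1R }
  where
  cleared-1R : ∀ rs → coeffAt 1R rs ℤ.* + denom 1 rs ≡ (if isSol 0 0 rs then + 1 else + 0)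
  cleared-1R rs with eqExps [] rs in eq
  ... | true = trans
    (cong₂ (λ c d → c ℤ.* + d) (coeffAt-resp-≐ 1R rs≐[]) (denom-resp-≐ 1 rs≐[]))
    (cong (λ b → if b then + 1 else + 0) (sym (isSol-resp-≐ 0 0 rs≐[])))
    where
    rs≐[] : rs ≐ []
    rs≐[] = ≐-sym (eqExps⇒≐ [] rs (subst T (sym eq) tt))
  ... | false = trans (cong (ℤ._* + denom 1 rs) (trans (ℤ.+-identityʳ _) (coeff≡0 rs rs≢)))
    (sym (if-≡0 (isSol 0 0 rs) λ sol → contradiction
      (sumR≡0⇒≐[] rs (ℕ.≡ᵇ⇒≡ _ 0 (T-∧ˡ (sumR rs ≡ᵇ 0) sol))) rs≢))
    where
    rs≢ : ¬ rs ≐ []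
    rs≢ rs≐[] = subst T eq (≐⇒eqExps [] rs (≐-sym rs≐[]))
    coeff≡0 : ∀ rs → ¬ rs ≐ [] → coeffTerm (term (+ 1) (+ 0) []) (+ lookupExp rs 0) (drop 1 rs) ≡ + 0
    coeff≡0 []       rs≢ = contradiction ≐-refl rs≢
    coeff≡0 (r ∷ rs) rs≢ = if-≡0 ((0 ≡ᵇ r) ∧ eqExps [] rs) λ eq → contradiction
      (≐-sym ([]-∷-≐ (sym (ℕ.≡ᵇ⇒≡ 0 r (T-∧ˡ (0 ≡ᵇ r) eq))) (eqExps⇒≐ [] rs (T-∧ʳ (0 ≡ᵇ r) eq)))) rs≢

-- The explicit formula

∑ₗ : ∀ {A : Set} → (A → ℤ) → List A → ℤ
∑ₗ f = foldr (λ x s → f x ℤ.+ s) (+ 0)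

∑ₗ-zero : ∀ {A : Set} {f : A → ℤ} xs → (∀ x → f x ≡ + 0) → ∑ₗ f xs ≡ + 0
∑ₗ-zero []       f≡0 = refl
∑ₗ-zero (x ∷ xs) f≡0 = cong₂ ℤ._+_ (f≡0 x) (∑ₗ-zero xs f≡0)

∑ₗ-cong : ∀ {A : Set} {f g : A → ℤ} xs → (∀ x → f x ≡ g x) → ∑ₗ f xs ≡ ∑ₗ g xs
∑ₗ-cong []       f≡g = refl
∑ₗ-cong (x ∷ xs) f≡g = cong₂ ℤ._+_ (f≡g x) (∑ₗ-cong xs f≡g)

∑ₗ-++ : ∀ {A : Set} (f : A → ℤ) xs ys → ∑ₗ f (xs ++ ys) ≡ ∑ₗ f xs ℤ.+ ∑ₗ f ys
∑ₗ-++ f []       ys = sym (ℤ.+-identityˡ _)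
∑ₗ-++ f (x ∷ xs) ys = trans (cong (λ s → f x ℤ.+ s) (∑ₗ-++ f xs ys)) (sym (ℤ.+-assoc (f x) _ _))

∑ₗ-map : ∀ {A B : Set} (f : B → ℤ) (g : A → B) xs → ∑ₗ f (map g xs) ≡ ∑ₗ (f ∘ g) xs
∑ₗ-map f g []       = refl
∑ₗ-map f g (x ∷ xs) = cong (λ s → f (g x) ℤ.+ s) (∑ₗ-map f g xs)

∑ₗ-concatMap : ∀ {A B : Set} (f : B → ℤ) (g : A → List B) xs →
               ∑ₗ f (concatMap g xs) ≡ ∑ₗ (λ x → ∑ₗ f (g x)) xs
∑ₗ-concatMap f g []       = refl
∑ₗ-concatMap f g (x ∷ xs) = trans (∑ₗ-++ f (g x) (concatMap g xs))
  (cong (λ s → ∑ₗ f (g x) ℤ.+ s) (∑ₗ-concatMap f g xs))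

∑ₗ-applyUpTo : ∀ (f : ℕ → ℤ) (g : ℕ → ℕ) n b → b < n → (∀ i → i ≢ b → f (g i) ≡ + 0) →
               ∑ₗ f (applyUpTo g n) ≡ f (g b)
∑ₗ-applyUpTo f g (suc n) zero    b<n f≡0 = trans
  (cong (λ s → f (g 0) ℤ.+ s) (rest n (g ∘ suc) λ i → f≡0 (suc i) λ ())) (ℤ.+-identityʳ _)
  where
  rest : ∀ n h → (∀ i → f (h i) ≡ + 0) → ∑ₗ f (applyUpTo h n) ≡ + 0
  rest zero    h f≡0 = refl
  rest (suc n) h f≡0 = cong₂ ℤ._+_ (f≡0 0) (rest n (h ∘ suc) (f≡0 ∘ suc))
∑ₗ-applyUpTo f g (suc n) (suc b) (s≤s b<n) f≡0 = trans
  (cong₂ ℤ._+_ (f≡0 0 λ ()) (∑ₗ-applyUpTo f (g ∘ suc) n b b<n λ i i≢b → f≡0 (suc i) (i≢b ∘ ℕ.suc-injective)))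
  (ℤ.+-identityˡ _)

lookup-drop : ∀ rs i → lookupExp (drop 1 rs) i ≡ lookupExp rs (suc i)
lookup-drop []       i = refl
lookup-drop (r ∷ rs) i = refl

eqExps-∷ : ∀ r rs ss → eqExps (r ∷ rs) ss ≡ (r ≡ᵇ lookupExp ss 0) ∧ eqExps rs (drop 1 ss)
eqExps-∷ r rs []       = refl
eqExps-∷ r rs (s ∷ ss) = refl

-- Up to trailing zeros, `ss` occurs exactly once in the enumeration when its entries are at most
-- `K` and sit in the first `m` positions.
∑ₗ-tuples : ∀ m K ss x → (∀ i → lookupExp ss i ≤ K) → (∀ i → m ≤ i → lookupExp ss i ≡ 0) →
            ∑ₗ (λ rs → if eqExps rs ss then x else + 0) (tuples m K) ≡ x
∑ₗ-tuples zero K ss x ss≤K ss≡0 = trans (ℤ.+-identityʳ _)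
  (cong (λ b → if b then x else + 0)
    (T-ext {b = true} (λ _ → tt) (λ _ → ≐⇒eqExps [] ss (mk≐ λ i → sym (ss≡0 i z≤n)))))
∑ₗ-tuples (suc m) K ss x ss≤K ss≡0 = begin
  ∑ₗ f (concatMap (λ r → map (r ∷_) (tuples m K)) (upTo (suc K)))
    ≡⟨ ∑ₗ-concatMap f (λ r → map (r ∷_) (tuples m K)) (upTo (suc K)) ⟩
  ∑ₗ (λ r → ∑ₗ f (map (r ∷_) (tuples m K))) (upTo (suc K))
    ≡⟨ ∑ₗ-applyUpTo _ (λ r → r) (suc K) (lookupExp ss 0) (s≤s (ss≤K 0)) (λ r r≢ →
         trans (∑ₗ-map f (r ∷_) (tuples m K)) (∑ₗ-zero (tuples m K) λ rs →
           if-≡0 (eqExps (r ∷ rs) ss) λ eq → contradiction (at (eqExps⇒≐ (r ∷ rs) ss eq) 0) r≢)) ⟩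
  ∑ₗ f (map (lookupExp ss 0 ∷_) (tuples m K))
    ≡⟨ ∑ₗ-map f (lookupExp ss 0 ∷_) (tuples m K) ⟩
  ∑ₗ (λ rs → f (lookupExp ss 0 ∷ rs)) (tuples m K)
    ≡⟨ ∑ₗ-cong (tuples m K) (λ rs → cong (λ b → if b then x else + 0)
         (trans (eqExps-∷ _ rs ss) (T-ext (T-∧ʳ (lookupExp ss 0 ≡ᵇ lookupExp ss 0)) (∧-T (ℕ.≡⇒≡ᵇ (lookupExp ss 0) _ refl))))) ⟩
  ∑ₗ (λ rs → if eqExps rs (drop 1 ss) then x else + 0) (tuples m K)
    ≡⟨ ∑ₗ-tuples m K (drop 1 ss) x
         (λ i → ℕ.≤-trans (ℕ.≤-reflexive (lookup-drop ss i)) (ss≤K (suc i)))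
         (λ i m≤i → trans (lookup-drop ss i) (ss≡0 (suc i) (s≤s m≤i))) ⟩
  x ∎
  where
  open ≡.≡-Reasoning
  f : List ℕ → ℤ
  f rs = if eqExps rs ss then x else + 0

addExps-unitExps-replicate : ∀ i r rs → addExps (unitExps i r) (replicate (suc i) 0 ++ rs) ≡ replicate i 0 ++ r ∷ rs
addExps-unitExps-replicate zero    r rs = cong (_∷ rs) (ℕ.+-identityʳ r)
addExps-unitExps-replicate (suc i) r rs = cong (0 ∷_) (addExps-unitExps-replicate i r rs)

replicate-≐-[] : ∀ i → [] ≐ (replicate i 0 ++ [])
replicate-≐-[] zero    = ≐-refl
replicate-≐-[] (suc i) = []-∷-≐ refl (replicate-≐-[] i)

-- Position `i` of the list holds the exponent of X_{i+2}, hence the leading zeros. For empty `rs`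
-- these zeros are trailing ones, which is why only `≋` is claimed.
monoR-rest : ∀ i rs → monoR (suc (suc i)) rs ≋ (term (+ 1) (+ 0) (replicate i 0 ++ rs) ∷ [])
monoR-rest i []       = term-resp-≐ (+ 1) (+ 0) (replicate-≐-[] i)
monoR-rest i (r ∷ rs) = ≋-trans (*R-congˡ (Xpow (suc (suc i)) r) (monoR-rest (suc i) rs))
  (≡⇒≋ (cong (λ as → term (+ 1) (+ 0) as ∷ []) (addExps-unitExps-replicate i r rs)))

scale-monoR : ∀ c rs → scale c (monoR 1 rs) ≋ (term c (+ lookupExp rs 0) (drop 1 rs) ∷ [])
scale-monoR c []       = ≡⇒≋ (cong (λ x → term x (+ 0) [] ∷ []) (ℤ.*-identityʳ c))
scale-monoR c (r ∷ rs) = ≋-trans (≡⇒≋ (scale≡const c (monoR 1 (r ∷ rs))))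
  (≋-trans (*R-congˡ (const c) (*R-congˡ (X₁^ (+ r)) (monoR-rest 0 rs)))
    (≡⇒≋ (cong₂ (λ x e → term x (+ e) rs ∷ []) (ℤ.*-identityʳ c) (ℕ.+-identityʳ r))))

coeff-scale-monoR-negative : ∀ c rs m as → coeff (scale c (monoR 1 rs)) -[1+ m ] as ≡ + 0
coeff-scale-monoR-negative c rs m as = coeffs (scale-monoR c rs) -[1+ m ] as

coeffAt-scale-monoR : ∀ c rs ss → coeffAt (scale c (monoR 1 rs)) ss ≡ (if eqExps rs ss then c else + 0)
coeffAt-scale-monoR c rs ss = trans (coeffs (scale-monoR c rs) _ _)
  (trans (ℤ.+-identityʳ _) (cong (λ b → if b then c else + 0) (split rs ss)))
  where
  split : ∀ rs ss → (lookupExp rs 0 ≡ᵇ lookupExp ss 0) ∧ eqExps (drop 1 rs) (drop 1 ss) ≡ eqExps rs ss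
  split []       []           = refl
  split []       (zero ∷ ss)  = refl
  split []       (suc s ∷ ss) = refl
  split (r ∷ rs) ss           = sym (eqExps-∷ r rs ss)

-- The body of `B` with the list of tuples made a variable, so that induction on it is possible.
bellSum : ℕ → ℕ → List (List ℕ) → Poly
bellSum n k xs = foldr _+R_ 0R
  (map (λ rs → scale (+ divℕ (n !) (denom 1 rs)) (monoR 1 rs)) (filterᵇ (isSol n k) xs))

coeff-bellSum-negative : ∀ n k xs m as → coeff (bellSum n k xs) -[1+ m ] as ≡ + 0
coeff-bellSum-negative n k []        m as = refl
coeff-bellSum-negative n k (rs ∷ xs) m as with isSol n k rs
... | false = coeff-bellSum-negative n k xs m as
... | true  = trans (coeff-++ (scale (+ divℕ (n !) (denom 1 rs)) (monoR 1 rs)) (bellSum n k xs) -[1+ m ] as)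
  (cong₂ ℤ._+_ (coeff-scale-monoR-negative (+ divℕ (n !) (denom 1 rs)) rs m as) (coeff-bellSum-negative n k xs m as))

bellCoeff : ℕ → ℕ → List ℕ → ℤ
bellCoeff n k rs = if isSol n k rs then + divℕ (n !) (denom 1 rs) else + 0

bellCoeff-resp-≐ : ∀ n k {rs ss} → rs ≐ ss → bellCoeff n k rs ≡ bellCoeff n k ss
bellCoeff-resp-≐ n k rs≐ss = cong₂ (λ b d → if b then + divℕ (n !) d else + 0)
  (isSol-resp-≐ n k rs≐ss) (denom-resp-≐ 1 rs≐ss)

-- Where `eqExps` succeeds, `bellCoeff` agrees at `rs` and `ss`; the selected value can thus be made
-- independent of `rs`, the form that `∑ₗ-tuples` evaluates.
coeffAt-bellSum : ∀ n k xs ss →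
  coeffAt (bellSum n k xs) ss ≡ ∑ₗ (λ rs → if eqExps rs ss then bellCoeff n k ss else + 0) xs
coeffAt-bellSum n k xs ss = trans (go xs) (∑ₗ-cong xs λ rs →
  if-congᵀ (eqExps rs ss) λ eq → bellCoeff-resp-≐ n k (eqExps⇒≐ rs ss eq))
  where
  go : ∀ xs → coeffAt (bellSum n k xs) ss ≡ ∑ₗ (λ rs → if eqExps rs ss then bellCoeff n k rs else + 0) xs
  go []        = refl
  go (rs ∷ xs) with isSol n k rs
  ... | true  = trans (coeff-++ (scale (+ divℕ (n !) (denom 1 rs)) (monoR 1 rs)) (bellSum n k xs) _ _)
    (cong₂ ℤ._+_ (coeffAt-scale-monoR (+ divℕ (n !) (denom 1 rs)) rs ss) (go xs))
  ... | false = trans (go xs) (sym (trans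
    (cong (ℤ._+ ∑ₗ (λ rs → if eqExps rs ss then bellCoeff n k rs else + 0) xs) (if-≡0 (eqExps rs ss) λ _ → refl))
    (ℤ.+-identityˡ _)))

B-suc-≤ : ∀ {n k} → k ≤ n → B (suc n) (suc k) ≡ bellSum (suc n) (suc k) (tuples (suc n ∸ k) (suc k))
B-suc-≤ {n} {k} k≤n with suc n ℕ.<ᵇ suc k in eq
... | true  = contradiction (ℕ.<ᵇ⇒< n k (subst T (sym eq) tt)) (ℕ.≤⇒≯ k≤n)
... | false = refl

-- Remove one unit at position `i`, of weight i + 1. The other k - 1 units weigh at least 1 each, so
-- n ≥ (i + 1) + (k - 1). Hence tuples of length n - k + 1 contain all solutions.
isSol-lookup-bound : ∀ n k rs i → T (isSol n k rs) → lookupExp rs i ≢ 0 → i ℕ.+ k ≤ n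
isSol-lookup-bound n k rs i sol rᵢ≢0 = begin
  i ℕ.+ k                        ≡⟨ cong (i ℕ.+_) (ℕ.≡ᵇ⇒≡ _ k (T-∧ˡ (sumR rs ≡ᵇ k) sol)) ⟨
  i ℕ.+ sumR rs                  ≡⟨ cong (i ℕ.+_) (trans (sumR-resp-≐ rs≐) (sumR-unit i ss)) ⟩
  i ℕ.+ suc (sumR ss)            ≡⟨ ℕ.+-suc i (sumR ss) ⟩
  suc i ℕ.+ sumR ss              ≤⟨ ℕ.+-monoʳ-≤ (suc i) (sumR≤weightedSum 0 ss) ⟩
  suc i ℕ.+ weightedSum 1 ss     ≡⟨ trans (weightedSum-resp-≐ 1 rs≐) (weightedSum-unit 1 i ss) ⟨
  weightedSum 1 rs               ≡⟨ ℕ.≡ᵇ⇒≡ _ n (T-∧ʳ (sumR rs ≡ᵇ k) sol) ⟩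
  n                              ∎
  where
  open ℕ.≤-Reasoning
  ss = decExp rs i
  rs≐ : rs ≐ addExps (unitExps i 1) ss
  rs≐ = ≐-sym (addExps-unit-decExp rs i rᵢ≢0)

coeffAt-B : ∀ {n k} → k ≤ n → ∀ rs → coeffAt (B (suc n) (suc k)) rs ≡ bellCoeff (suc n) (suc k) rs
coeffAt-B {n} {k} k≤n rs = trans (cong (λ p → coeffAt p rs) (B-suc-≤ k≤n))
  (trans (coeffAt-bellSum (suc n) (suc k) (tuples (suc n ∸ k) (suc k)) rs) collapse)
  where
  collapse : ∑ₗ (λ ss → if eqExps ss rs then bellCoeff (suc n) (suc k) rs else + 0) (tuples (suc n ∸ k) (suc k)) ≡
             bellCoeff (suc n) (suc k) rs
  collapse with isSol (suc n) (suc k) rs in eq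
  ... | false = ∑ₗ-zero (tuples (suc n ∸ k) (suc k)) λ ss → if-≡0 (eqExps ss rs) λ _ → refl
  ... | true  = ∑ₗ-tuples (suc n ∸ k) (suc k) rs _
    (λ i → ℕ.≤-trans (lookup≤sumR rs i) (ℕ.≤-reflexive (ℕ.≡ᵇ⇒≡ _ (suc k) (T-∧ˡ (sumR rs ≡ᵇ suc k) sol))))
    vanish
    where
    sol : T (isSol (suc n) (suc k) rs)
    sol = subst T (sym eq) tt
    vanish : ∀ i → suc n ∸ k ≤ i → lookupExp rs i ≡ 0
    vanish i m≤i with lookupExp rs i ℕ.≟ 0
    ... | yes rᵢ≡0 = rᵢ≡0
    ... | no  rᵢ≢0 = contradiction
      (ℕ.≤-trans (ℕ.m≤n+m∸n (suc n) k) (ℕ.≤-trans (ℕ.+-monoʳ-≤ k m≤i) (ℕ.≤-reflexive (ℕ.+-comm k i))))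
      (ℕ.<⇒≱ (ℕ.≤-trans (ℕ.≤-reflexive (sym (ℕ.+-suc i k))) (isSol-lookup-bound (suc n) (suc k) rs i sol rᵢ≢0)))

divℕ-exact : ∀ c d m → c ℤ.* + d ≡ + m → divℕ m d ℕ.* d ≡ m
divℕ-exact c zero    m eq = ℤ.+-injective (trans (sym (ℤ.*-zeroʳ c)) eq)
divℕ-exact c (suc d) m eq = m/n*n≡m (divides ℤ.∣ c ∣ (trans (cong ℤ.∣_∣ (sym eq)) (ℤ.abs-* c (+ suc d))))

-- Any `p` satisfying the cleared equations has integer coefficients, and on a solution such a
-- coefficient is a quotient of the factorial by the denominator. Its existence is the proof that
-- the division in `B` is exact.
isBell-explicit : ∀ {n k p} → k ≤ n → IsBell (suc n) (suc k) p → IsBell (suc n) (suc k) (B (suc n) (suc k))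
isBell-explicit {n} {k} {p} k≤n bp = record
  { negative = λ m as → trans (cong (λ p → coeff p -[1+ m ] as) (B-suc-≤ k≤n))
      (coeff-bellSum-negative (suc n) (suc k) (tuples (suc n ∸ k) (suc k)) m as)
  ; cleared = λ rs → trans (cong (ℤ._* + denom 1 rs) (coeffAt-B k≤n rs)) (exact rs (cleared bp rs)) }
  where
  exact : ∀ rs → coeffAt p rs ℤ.* + denom 1 rs ≡ (if isSol (suc n) (suc k) rs then + (suc n !) else + 0) →
          bellCoeff (suc n) (suc k) rs ℤ.* + denom 1 rs ≡ (if isSol (suc n) (suc k) rs then + (suc n !) else + 0)
  exact rs eq with isSol (suc n) (suc k) rs
  ... | true  = trans (sym (ℤ.pos-* (divℕ (suc n !) (denom 1 rs)) (denom 1 rs)))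
    (cong +_ (divℕ-exact (coeffAt p rs) (denom 1 rs) (suc n !) eq))
  ... | false = refl

isBell-B : ∀ n k → IsBell n k (B n k)
isBell-B zero    zero    = isBell-corner
isBell-B zero    (suc k) = isBell-lower (s≤s z≤n)
isBell-B (suc n) zero    = isBell-column n
isBell-B (suc n) (suc k) with n ℕ.<? k
... | yes n<k = isBell-lower (s≤s n<k)
-- The polynomial built by the recurrence from the preceding row serves as the witness of
-- integrality.
... | no  n≮k = isBell-explicit (ℕ.≮⇒≥ n≮k) (isBell-step (isBell-B n k) (isBell-B n (suc k)) ℕ.≤-refl)

B-suc : ∀ {n N} k → n ≤ N → B (suc n) (suc k) ≋ X 1 *R B n k +R D N (B n (suc k))
B-suc {n} k n≤N = isBell-unique (isBell-B (suc n) (suc k)) (isBell-step (isBell-B n k) (isBell-B n (suc k)) n≤N)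

-- The triangles A and B are inverse to each other

A-lower : ∀ {n k} → n < k → A n k ≋ 0R
A-lower {n} n<k = ≋-trans (≡⇒≋ (cong (X₁^ (κ n) *R_) (S-lower n<k))) (R.zeroʳ (X₁^ (κ n)))

A-isTriangle : ∀ N → 0 < N → IsTriangle N (D N) (X₁^ (ℤ.- + 1)) (X₁^ (ℤ.- + 1)) A
A-isTriangle N 0<N = record
  { corner = ≋-refl
  ; column = λ n → ≋-refl
  ; lower  = A-lower
  ; step   = λ k n<N → A-suc k (ℕ.<⇒≤ n<N) 0<N }

B-isTriangle : ∀ N → IsTriangle N (D N) (X 1) 1R B
B-isTriangle N = record
  { corner = ≋-refl
  ; column = λ n → ≋-refl
  ; lower  = λ n<k → ≡⇒≋ (B-lower n<k)
  ; step   = λ {n} k n<N → ≋-trans (B-suc k (ℕ.<⇒≤ n<N))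
      (R.+-congˡ {X 1 *R B n k} (≋-sym (R.*-identityˡ (D N (B n (suc k)))))) }

δ≡kronecker : ∀ n k → δ n k ≡ kronecker n k
δ≡kronecker zero    zero    = refl
δ≡kronecker zero    (suc k) = refl
δ≡kronecker (suc n) zero    = refl
δ≡kronecker (suc n) (suc k) = trans (δ-suc n k) (δ≡kronecker n k)
  where
  δ-suc : ∀ n k → δ (suc n) (suc k) ≡ δ n k
  δ-suc n k with n ≡ᵇ k
  ... | true  = refl
  ... | false = refl

sumFromTo-kronecker : ∀ {a b a′ b′ P Q} n k → a *R a′ ≋ 1R → a *R b′ ≋ b →
  IsTriangle (suc n) (D (suc n)) a b P → IsTriangle (suc n) (D (suc n)) a′ b′ Q →
  k ≤ n → sumFromTo k n (λ j → P n j *R Q j k) ≈ δ n k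
sumFromTo-kronecker {P = P} {Q} n k aa′≋1 ab′≋b isP isQ k≤n = coeffs (begin
  sumFromTo k n (λ j → P n j *R Q j k)
    ≡⟨ sumFromTo≡∑ k n _ ⟩
  ∑ (suc n ∸ k) (λ i → P n (k ℕ.+ i) *R Q (k ℕ.+ i) k)
    -- The terms with j < k vanish by triangularity of `Q`, so the sum may start at 0.
    ≈⟨ ∑-drop (ℕ.m≤n⇒m≤1+n k≤n) _ (λ j j<k →
         R.trans (R.*-congˡ {P n j} (IsTriangle.lower isQ j<k)) (R.zeroʳ (P n j))) ⟩
  ∑ (suc n) (λ j → P n j *R Q j k)
    ≈⟨ orthogonality (D-isDerivation (suc n)) aa′≋1 ab′≋b isP isQ n (ℕ.n≤1+n n) k ⟩
  kronecker n k
    ≡⟨ δ≡kronecker n k ⟨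
  δ n k ∎)
  where open ≋-Reasoning

theorem5p1 : (n k : ℕ) → 1 ≤ k → k ≤ n →
    (sumFromTo k n (λ j → A n j *R B j k) ≈ δ n k)
    × (sumFromTo k n (λ j → B n j *R A j k) ≈ δ n k)
theorem5p1 n k _ k≤n =
  -- Here a = b = X_1⁻¹, a′ = X_1 and b′ = 1; in the second component the roles are exchanged and
  -- both conditions read X_1 X_1⁻¹ = 1, which holds by evaluation.
  sumFromTo-kronecker n k ≋-refl (R.*-identityʳ (X₁^ (ℤ.- + 1))) A-triangle B-triangle k≤n ,
  sumFromTo-kronecker n k ≋-refl ≋-refl B-triangle A-triangle k≤n
  where
  -- Truncating at n + 1 reaches row n, as `orthogonality` requires, and is visibly positive, as
  -- `A-suc` requires.
  A-triangle = A-isTriangle (suc n) (s≤s z≤n)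
  B-triangle = B-isTriangle (suc n)
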